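{- For every fixed integer $k\ge 2$, the maximum iteration number of $k$-WL on graphs is in $\Omega(n^{k/2})$. That is, for every $k\ge 2$ there are a constant $c_k>0$ and an integer $n_k$ such that for every $n\ge n_k$ there is a (colored) graph on $n$ vertices on which the iteration number of $k$-WL is at least $c_k\, n^{k/2}$.
   Context: All graphs are finite, simple, undirected and (vertex-)colored: a colored graph is $G=(V,E,c)$ with $c\colon V\to\mathbb N$ an arbitrary coloring of the vertices; isomorphisms preserve colors. The $k$-dimensional Weisfeiler-Leman algorithm ($k$-WL, $k\ge2$) on $G=(V,E,c)$ computes colorings $\chi_k^{(r)}$ of $V^k$ for $r=0,1,2,\dots$. Initially $\chi_k^{(0)}(\bar u)=\chi_k^{(0)}(\bar v)$ for $\bar u=(u_1,\dots,u_k)$ and $\bar v=(v_1,\dots,v_k)$ if and only if $u_i\mapsto v_i$ ($1\le i\le k$) defines an isomorphism (of colored graphs) from the induced subgraph $G[\{u_1,\dots,u_k\}]$ to $G[\{v_1,\dots,v_k\}]$. Then $$\chi_k^{(r+1)}(\bar u)=\Big(\chi_k^{(r)}(\bar u),\ \big\{\!\!\big\{\big(\chi_k^{(r)}(\bar u[w/1]),\dots,\chi_k^{(r)}(\bar u[w/k])\big)\ \big|\ w\in V\big\}\!\!\big\}\Big),$$ where $\{\!\!\{\cdot\}\!\!\}$ denotes a multiset and $\bar u[w/i]$ is $\bar u$ with its $i$-th entry replaced by $w$. Two colorings of $V^k$ are equivalent if they induce the same partition of $V^k$ into color classes. The iteration number of $k$-WL on $G$ is the minimal $r$ such that $\chi_k^{(r)}$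 and $\chi_k^{(r+1)}$ are equivalent. -}

module Defs where

open import Data.Bool.Base using (Bool; false)
open import Data.Fin.Base using (Fin)
open import Data.Integer.Base using (+_)
open import Data.List.Base as List using (List; allFin)
open import Data.List.Relation.Binary.Permutation.Setoid using (↭-setoid)
open import Data.Nat.Base as ℕ using (ℕ; zero; suc)
open import Data.Product.Base using (_×_; _,_)
open import Data.Product.Relation.Binary.Pointwise.NonDependent using (_×ₛ_)
open import Data.Rational.Base as ℚ using (ℚ; _/_)
open import Data.Vec.Base as Vec using (Vec; lookup; tabulate; _[_]≔_)
open import Data.Vec.Relation.Binary.Equality.Setoid using (≋-setoid)
open import Function.Base using (_∘_)
open import Function.Bundles using (_⇔_)
open import Level using (0ℓ)
open import Relation.Binary.Bundles using (Setoid)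
open import Relation.Binary.Definitions using (Reflexive; Symmetric; Transitive)
open import Relation.Binary.PropositionalEquality.Core
  using (_≡_; refl; sym; trans)

record ColoredGraph (n : ℕ) : Set where
  field
    adj        : Fin n → Fin n → Bool
    adj-sym    : ∀ u v → adj u v ≡ adj v u
    adj-irrefl : ∀ v → adj v v ≡ false
    color      : Fin n → ℕ

Tuple : ℕ → ℕ → Set
Tuple n k = Vec (Fin n) k

-- The assignment uᵢ ↦ vᵢ defines an isomorphism of colored graphs
-- G[{u₁,…,uₖ}] → G[{v₁,…,vₖ}].  It is onto {v₁,…,vₖ} by construction.
record DefinesIso {n k : ℕ} (G : ColoredGraph n) (u v : Tuple n k) : Set where
  open ColoredGraph G
  field
    well-defined    : ∀ i j → lookup u i ≡ lookup u j → lookup v i ≡ lookup v j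
    injective       : ∀ i j → lookup v i ≡ lookup v j → lookup u i ≡ lookup u j
    preserves-adj   : ∀ i j → adj (lookup u i) (lookup u j) ≡ adj (lookup v i) (lookup v j)
    preserves-color : ∀ i → color (lookup u i) ≡ color (lookup v i)

module _ {n k : ℕ} {G : ColoredGraph n} where
  open DefinesIso

  DefinesIso-refl : Reflexive (DefinesIso {k = k} G)
  DefinesIso-refl .well-defined    _ _ eq = eq
  DefinesIso-refl .injective       _ _ eq = eq
  DefinesIso-refl .preserves-adj   _ _    = refl
  DefinesIso-refl .preserves-color _      = refl

  DefinesIso-sym : Symmetric (DefinesIso {k = k} G)
  DefinesIso-sym p .well-defined        = injective p
  DefinesIso-sym p .injective           = well-defined p
  DefinesIso-sym p .preserves-adj   i j = sym (preserves-adj p i j)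
  DefinesIso-sym p .preserves-color i   = sym (preserves-color p i)

  DefinesIso-trans : Transitive (DefinesIso {k = k} G)
  DefinesIso-trans p q .well-defined    i j = well-defined q i j ∘ well-defined p i j
  DefinesIso-trans p q .injective       i j = injective p i j ∘ injective q i j
  DefinesIso-trans p q .preserves-adj   i j = trans (preserves-adj p i j) (preserves-adj q i j)
  DefinesIso-trans p q .preserves-color i   = trans (preserves-color p i) (preserves-color q i)

-- Colors are elements of a setoid, "same color" being its equality.  An initial
-- color is named by any tuple that has it.
initialColors : ∀ {n} → ColoredGraph n → ℕ → Setoid 0ℓ 0ℓ
initialColors {n} G k = record
  { Carrier       = Tuple n k
  ; _≈_           = DefinesIso G
  ; isEquivalence = record
    { refl  = DefinesIso-refl
    ; sym   = DefinesIso-sym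
    ; trans = DefinesIso-trans
    }
  }

-- Finite multisets: lists up to permutation and equality of their elements.
multiset : Setoid 0ℓ 0ℓ → Setoid 0ℓ 0ℓ
multiset S = ↭-setoid S

WLColors : ∀ {n} → ColoredGraph n → (k r : ℕ) → Setoid 0ℓ 0ℓ
WLColors G k zero    = initialColors G k
WLColors G k (suc r) = WLColors G k r ×ₛ multiset (≋-setoid (WLColors G k r) k)

χ : ∀ {n} (G : ColoredGraph n) (k r : ℕ) → Tuple n k → Setoid.Carrier (WLColors G k r)
χ     G k zero    u = u
χ {n} G k (suc r) u =
  χ G k r u , List.map (λ w → tabulate (λ i → χ G k r (u [ i ]≔ w))) (allFin n)

-- Two colorings, possibly with different sets of colors, induce the same partition.
Equivalent : {A : Set} (C D : Setoid 0ℓ 0ℓ) →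
             (A → Setoid.Carrier C) → (A → Setoid.Carrier D) → Set
Equivalent C D f g = ∀ x y → (f x ≈₁ f y) ⇔ (g x ≈₂ g y)
  where open Setoid C using () renaming (_≈_ to _≈₁_)
        open Setoid D using () renaming (_≈_ to _≈₂_)

Stable : ∀ {n} → ColoredGraph n → (k r : ℕ) → Set
Stable G k r = Equivalent (WLColors G k r) (WLColors G k (suc r)) (χ G k r) (χ G k (suc r))

IsIterationNumber : ∀ {n} → ColoredGraph n → (k r : ℕ) → Set
IsIterationNumber G k r = Stable G k r × (∀ s → Stable G k s → r ℕ.≤ s)

-- r ≥ c · n^(k/2), squared so as to avoid irrational powers; both sides of the
-- original inequality are nonnegative when c is.
AtLeastHalfPower : (c : ℚ) (n k r : ℕ) → Set
AtLeastHalfPower c n k r = (c ℚ.* c) ℚ.* (+ (n ℕ.^ k) / 1) ℚ.≤ + (r ℕ.* r) / 1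

{-# OPTIONS --safe #-}

-- On the graph of a linear system, k-WL plays a pebble game in which Duplicator keeps a solution
-- and Spoiler looks at the variables of k equations.  The system describes flows on a cylinder
-- with k cyclically arranged rows, compressed as follows: row i has its columns modulo
-- pᵢ pᵢ₊₁, and the cross edges between rows i - 1 and i are identified modulo pᵢ.  For pairwise
-- coprime pᵢ of order √n there are O(n) vertices, but the k pebbles on a column only return to
-- the same place after ∏ pᵢ = Θ(n^(k/2)) steps.  The rows are connected to a sink at column 0
-- which forbids a nonzero total flow.
--
-- Spoiler, who has k pebbles on a column through which there is a nonzero total flow, wins by
-- moving them to the sink, column by column.  Duplicator survives until then: a position that is not
-- a column (up to one step between neighbouring rows) does not separate anything, and she can
-- cancel the flow without changing what Spoiler sees, after which she never loses.  Each
-- residue is seen by two pebbles, so that moving a single pebble of a column gives either a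
-- column at a neighbouring time or no column.  Hence Spoiler needs as many rounds as there are
-- columns up to the sink.

module Submission where

open import Defs
open import Algebra.Properties.CommutativeMonoid.Sum using (sum; sum-cong-≗; ∑-distrib-+; sum-permute)
open import Data.Bool.Base using (true)
import Data.Bool.Properties as Bool
open import Data.Empty using (⊥; ⊥-elim)
open import Data.Fin.Base as Fin
  using (Fin; zero; suc; toℕ; fromℕ<; splitAt; combine; remQuot; _↑ˡ_; _↑ʳ_; finToFun; funToFin)
open import Data.Fin.Permutation as Perm using (_⟨$⟩ʳ_)
import Data.Fin.Properties as Fin
open import Data.Integer.Base as ℤ using (ℤ; +_; -[1+_]; 0ℤ; 1ℤ; -1ℤ; ∣_∣; _+_; _*_; -_; _-_)
import Data.Integer.DivMod as ℤ
import Data.Integer.Properties as ℤ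
open import Data.Integer.Tactic.RingSolver using (solve-∀)
open import Data.List.Base as List using (List; []; _∷_; _++_; length; allFin)
open import Data.List.Membership.Propositional using (_∈_)
import Data.List.Membership.Propositional.Properties as ∈ₚ
open import Data.List.Membership.Propositional.Properties.WithK using (unique∧set⇒bag)
import Data.List.Membership.Setoid.Properties as ∈ₛ
import Data.List.Properties as List
open import Data.List.Relation.Binary.BagAndSetEquality using (∼bag⇒↭)
import Data.List.Relation.Binary.Permutation.Propositional as ↭ₚ
import Data.List.Relation.Binary.Permutation.Propositional.Properties as ↭ₚP
import Data.List.Relation.Binary.Permutation.Setoid as ↭
import Data.List.Relation.Binary.Permutation.Setoid.Properties as ↭P
import Data.List.Relation.Binary.Pointwise as ListPw
open import Data.List.Relation.Unary.All as All using (All)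
import Data.List.Relation.Unary.All.Properties as All
open import Data.List.Relation.Unary.Any as Any using (Any; here; there; any?)
import Data.List.Relation.Unary.Unique.Propositional.Properties as Unique
open import Data.Maybe.Base using (Maybe; just; nothing)
import Data.Maybe.Properties as Maybe
open import Data.Nat.Base as ℕ using (ℕ; zero; suc; _≤_; _<_; z≤n; s≤s; NonZero; _!)
open import Data.Nat.Coprimality as Coprime using (Coprime)
import Data.Nat.DivMod as ℕ
import Data.Nat.Divisibility as ℕ
import Data.Nat.Properties as ℕ
open import Data.Nat.Tactic.RingSolver renaming (solve-∀ to solve-∀ℕ)
open import Data.Product.Base using (∃-syntax; _×_; _,_; proj₁; proj₂; uncurry)
import Data.Product.Properties as Product
open import Data.Rational.Base as ℚ using (ℚ; 0ℚ; _/_) renaming (_<_ to _<ℚ_)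
import Data.Rational.Properties as ℚ
open import Data.Rational.Unnormalised.Base as ℚᵘ using (mkℚᵘ; *≤*; *<*)
import Data.Rational.Unnormalised.Properties as ℚᵘ
open import Data.Sum.Base as Sum using (_⊎_; inj₁; inj₂)
import Data.Sum.Properties as Sum
open import Data.Unit.Base using (⊤; tt)
import Data.Unit.Properties as ⊤
open import Data.Vec.Base as Vec using (Vec; []; _∷_; lookup; tabulate; _[_]≔_)
import Data.Vec.Properties as Vec
open import Data.Vec.Relation.Binary.Equality.Setoid using (≋-setoid)
import Data.Vec.Relation.Binary.Pointwise.Inductive as VecPw
open import Function.Base using (_∘_; id; case_of_)
open import Function.Bundles using (_⇔_; mk⇔; Equivalence)
open import Level using (0ℓ)
open import Relation.Binary.Bundles using (Setoid)
open import Relation.Binary.Definitions using (Decidable; DecidableEquality; tri<; tri≈; tri>)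
open import Relation.Binary.PropositionalEquality
  using (_≡_; _≢_; _≗_; refl; sym; trans; cong; cong₂; subst; subst₂; module ≡-Reasoning)
open import Relation.Nullary.Decidable
  using (Dec; yes; no; does; map′; _×-dec_; _→-dec_; ¬?; dec-true; dec-false; does-⇔)
open import Relation.Nullary.Negation using (¬_; contradiction)
import Relation.Unary as U

-- Besides broken columns there are helices: neighbouring rows differ by at most one step, but the
-- steps add up to a nonzero winding number between -k and k. Such a position leaves no freedom to
-- local changes of the flow; its total changes only with a constant circulation around the
-- cylinder, by the winding number times that circulation. This dictates the arithmetic: the
-- violation is `k !`, a multiple of every possible winding number, and vertices carry values modulo
-- `k ! + 1`, where the violation stays nonzero.
--
-- Positions are known by residues, but the distance to the sink is counted in columns, so every
-- pebble gets an integer lift. Periods of at least 3 tell the steps -1, 0, 1 apart, and a vanishing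
-- winding number makes the lift close up when one pebble moves. Spoiler can walk in both
-- directions, so the start must be far from the sink on both sides.
--
-- The new vertex is named before it is known which pebble is given up. Duplicator's values at the
-- new place must therefore suit all k choices; only afterwards is the flow changed where no pebble
-- is left to see it.

-- Multiset equality: decidability and bijections.

module _ (S : Setoid 0ℓ 0ℓ) where
  open Setoid S using (_≈_) renaming (Carrier to A; refl to ≈-refl; sym to ≈-sym; trans to ≈-trans)
  open ↭ S using (_↭_; ↭-sym; ↭-trans; ↭-reflexive; prep; ↭-reflexive-≋)

  -- A common element can be cancelled from a permutation, so removing the first match of `x` from
  -- `ys` needs no backtracking.
  ↭-decidable : Decidable _≈_ → Decidable _↭_
  ↭-decidable _≈?_ [] []       = yes (↭-reflexive refl)
  ↭-decidable _≈?_ [] (y ∷ ys) = no λ p → ℕ.0≢1+n (↭P.xs↭ys⇒|xs|≡|ys| S p)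
  ↭-decidable _≈?_ (x ∷ xs) ys with any? (x ≈?_) ys
  ... | no x∉ys = no λ p → x∉ys (↭P.∈-resp-↭ S p (here ≈-refl))
  ... | yes x∈ys with ∈ₛ.∈-∃++ S x∈ys
  ... | as , bs , y , x≈y , eq with ↭-decidable _≈?_ xs (as ++ bs)
  ... | yes p = yes (↭-trans (prep x≈y p)
                  (↭-sym (↭-trans (↭-reflexive-≋ eq) (↭P.↭-shift S as bs))))
  ... | no ¬p = no λ q → ¬p (↭P.drop-∷ S (↭-trans q
                  (↭-trans (↭-reflexive-≋ eq) (↭-trans (↭P.↭-shift S as bs)
                    (prep (≈-sym x≈y) (↭-reflexive refl))))))

  lookup-tabulate′ : ∀ {n} (f : Fin n → A) i →
                     List.lookup (List.tabulate f) i ≡ f (Fin.cast (List.length-tabulate f) i)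
  lookup-tabulate′ {suc n} f zero    = refl
  lookup-tabulate′ {suc n} f (suc i) = lookup-tabulate′ (f ∘ suc) i

  ↭⇒bijection : ∀ {n} (f g : Fin n → A) →
                List.map f (allFin n) ↭ List.map g (allFin n) →
                ∃[ σ ] (∀ i → f i ≈ g (σ Perm.⟨$⟩ʳ i))
  ↭⇒bijection {n} f g p = σ , f≈g∘σ
    where
    q : List.tabulate f ↭ List.tabulate g
    q = subst (λ xs → xs ↭ List.tabulate g) (List.map-tabulate id f)
          (subst (λ xs → List.map f (allFin n) ↭ xs) (List.map-tabulate id g) p)
    cf = List.length-tabulate f
    cg = List.length-tabulate g
    π = ↭.onIndices q
    σ : Perm.Permutation n n
    σ = Perm.cast-id (sym cf) Perm.∘ₚ π Perm.∘ₚ Perm.cast-id cg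
    f≈g∘σ : ∀ i → f i ≈ g (σ Perm.⟨$⟩ʳ i)
    f≈g∘σ i = ≈-trans (Setoid.reflexive S (sym (List.lookup-tabulate f i)))
      (≈-trans (↭P.onIndices-lookup S q _) (Setoid.reflexive S (lookup-tabulate′ g _)))

  bijection⇒↭ : ∀ {n} (f g : Fin n → A) (σ : Perm.Permutation n n) →
                (∀ i → f i ≈ g (σ Perm.⟨$⟩ʳ i)) →
                List.map f (allFin n) ↭ List.map g (allFin n)
  bijection⇒↭ {n} f g σ f≈g∘σ =
    ↭-trans (↭-reflexive-≋ (ListPw.map⁺ f (g ∘ to) (ListPw.refl (λ {i} → f≈g∘σ i))))
      (subst (λ xs → xs ↭ List.map g (allFin n)) (sym (List.map-∘ (allFin n)))
        (↭ₚ.↭⇒↭ₛ′ (Setoid.isEquivalence S) (↭ₚP.map⁺ g perm)))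
    where
    to : Fin n → Fin n
    to = σ Perm.⟨$⟩ʳ_
    perm : List.map to (allFin n) ↭ₚ.↭ allFin n
    perm = ∼bag⇒↭ (unique∧set⇒bag
      (Unique.map⁺ (λ {x} {y} eq → trans (sym (Perm.inverseˡ σ)) (trans (cong (σ Perm.⟨$⟩ˡ_) eq) (Perm.inverseˡ σ)))
        (Unique.allFin⁺ n))
      (Unique.allFin⁺ n)
      (λ {j} → mk⇔ (λ _ → ∈ₚ.∈-allFin j)
        (λ _ → subst (_∈ List.map to (allFin n)) (Perm.inverseʳ σ)
                 (∈ₚ.∈-map⁺ to (∈ₚ.∈-allFin (σ Perm.⟨$⟩ˡ j))))))

-- Stabilization of the refinement and late splits.

module _ {A : Set} {P Q : A → Set} (P? : U.Decidable P) (Q? : U.Decidable Q) (Q⊆P : ∀ x → Q x → P x) where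

  filter-≤ : ∀ xs → length (List.filter Q? xs) ≤ length (List.filter P? xs)
  filter-≤ [] = z≤n
  filter-≤ (x ∷ xs) with Q? x | P? x
  ... | yes _ | yes _ = s≤s (filter-≤ xs)
  ... | yes q | no ¬p = ⊥-elim (¬p (Q⊆P x q))
  ... | no _  | yes _ = ℕ.m≤n⇒m≤1+n (filter-≤ xs)
  ... | no _  | no _  = filter-≤ xs

  filter-< : ∀ xs → Any (λ x → P x × ¬ Q x) xs → length (List.filter Q? xs) < length (List.filter P? xs)
  filter-< (x ∷ xs) (here (p , ¬q)) with Q? x | P? x
  ... | yes q | _     = ⊥-elim (¬q q)
  ... | no _  | yes _ = s≤s (filter-≤ xs)
  ... | no _  | no ¬p = ⊥-elim (¬p p)
  filter-< (x ∷ xs) (there any) with Q? x | P? x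
  ... | yes _ | yes _ = s≤s (filter-< xs any)
  ... | yes q | no ¬p = ⊥-elim (¬p (Q⊆P x q))
  ... | no _  | yes _ = ℕ.m≤n⇒m≤1+n (filter-< xs any)
  ... | no _  | no _  = filter-< xs any

least : ∀ {P : ℕ → Set} → U.Decidable P → ∀ {m} → P m → ∃[ r ] (P r × (∀ s → P s → r ≤ s))
least {P} P? {m} pm with P? 0
... | yes p0 = 0 , p0 , λ _ _ → z≤n
least {P} P? {zero}  pm | no ¬p0 = ⊥-elim (¬p0 pm)
least {P} P? {suc m} pm | no ¬p0 =
  let r , pr , min = least {P ∘ suc} (P? ∘ suc) pm
  in  suc r , pr , λ where
        zero    p0 → ⊥-elim (¬p0 p0)
        (suc s) ps → s≤s (min s ps)

module _ {n : ℕ} (G : ColoredGraph n) (k : ℕ) where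
  open ColoredGraph G

  SameColor : ℕ → Tuple n k → Tuple n k → Set
  SameColor r u v = Setoid._≈_ (WLColors G k r) (χ G k r u) (χ G k r v)

  private
    row : ∀ r → Tuple n k → Fin n → Vec (Setoid.Carrier (WLColors G k r)) k
    row r u w = Vec.tabulate (λ i → χ G k r (u [ i ]≔ w))

  sameColor-next : ∀ r {u v} → SameColor (suc r) u v →
    ∃[ σ ] (∀ w i → SameColor r (u [ i ]≔ w) (v [ i ]≔ (σ Perm.⟨$⟩ʳ w)))
  sameColor-next r {u} {v} (_ , p) =
    let σ , eq = ↭⇒bijection (≋-setoid (WLColors G k r) k) (row r u) (row r v) p
    in  σ , λ w → VecPw.tabulate⁻ (eq w)

  sameColor-suc : ∀ r {u v} → SameColor r u v → (σ : Perm.Permutation n n) →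
    (∀ w i → SameColor r (u [ i ]≔ w) (v [ i ]≔ (σ Perm.⟨$⟩ʳ w))) → SameColor (suc r) u v
  sameColor-suc r {u} {v} c σ eq =
    c , bijection⇒↭ (≋-setoid (WLColors G k r) k) (row r u) (row r v) σ (λ w → VecPw.tabulate⁺ (eq w))

  sameColor-≤ : ∀ {r s u v} → r ≤ s → SameColor s u v → SameColor r u v
  sameColor-≤ r≤s = go (ℕ.≤⇒≤′ r≤s)
    where
    go : ∀ {r s u v} → r ℕ.≤′ s → SameColor s u v → SameColor r u v
    go (ℕ.≤′-reflexive refl) c = c
    go (ℕ.≤′-step r≤s)       c = go r≤s (proj₁ c)

  definesIso? : Decidable (DefinesIso {k = k} G)
  definesIso? u v = map′
    (λ (a , b , c , d) → record { well-defined = a ; injective = b ; preserves-adj = c ; preserves-color = d })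
    (λ p → DefinesIso.well-defined p , DefinesIso.injective p , DefinesIso.preserves-adj p , DefinesIso.preserves-color p)
    (Fin.all? (λ i → Fin.all? (λ j → (lookup u i Fin.≟ lookup u j) →-dec (lookup v i Fin.≟ lookup v j)))
      ×-dec Fin.all? (λ i → Fin.all? (λ j → (lookup v i Fin.≟ lookup v j) →-dec (lookup u i Fin.≟ lookup u j)))
      ×-dec Fin.all? (λ i → Fin.all? (λ j → adj (lookup u i) (lookup u j) Bool.≟ adj (lookup v i) (lookup v j)))
      ×-dec Fin.all? (λ i → color (lookup u i) ℕ.≟ color (lookup v i)))

  ≈-decidable : ∀ r → Decidable (Setoid._≈_ (WLColors G k r))
  ≈-decidable zero = definesIso?
  ≈-decidable (suc r) (c , xs) (d , ys) =
    ≈-decidable r c d ×-dec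
    ↭-decidable (≋-setoid (WLColors G k r) k) (VecPw.decidable (≈-decidable r)) xs ys

  sameColor? : ∀ r → Decidable (SameColor r)
  sameColor? r u v = ≈-decidable r (χ G k r u) (χ G k r v)

  NoSplit : ℕ → Tuple n k × Tuple n k → Set
  NoSplit r (u , v) = SameColor r u v → SameColor (suc r) u v

  noSplit⇒stable : ∀ r → (∀ uv → NoSplit r uv) → Stable G k r
  noSplit⇒stable r h u v = mk⇔ (h (u , v)) proj₁

  stable⇒noSplit : ∀ {r} → Stable G k r → ∀ uv → NoSplit r uv
  stable⇒noSplit st (u , v) = Equivalence.to (st u v)

  stable-suc : ∀ {r} → Stable G k r → Stable G k (suc r)
  stable-suc {r} st = noSplit⇒stable (suc r) λ (u , v) c →
    let σ , eq = sameColor-next r c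
    in  sameColor-suc (suc r) c σ (λ w i → stable⇒noSplit st _ (eq w i))

  stable⇒sameColor : ∀ {r u v} → Stable G k r → SameColor r u v → ∀ s → SameColor s u v
  stable⇒sameColor {r} {u} {v} st c s = sameColor-≤ (ℕ.m≤n+m s r) (proj₂ (go s))
    where
    go : ∀ s → Stable G k (r ℕ.+ s) × SameColor (r ℕ.+ s) u v
    go zero rewrite ℕ.+-identityʳ r = st , c
    go (suc s) rewrite ℕ.+-suc r s =
      let st′ , c′ = go s in stable-suc st′ , stable⇒noSplit st′ _ c′

  private
    tuples : ∀ j → List (Vec (Fin n) j)
    tuples zero    = [] ∷ []
    tuples (suc j) = List.cartesianProductWith _∷_ (allFin n) (tuples j)

    ∈-tuples : ∀ {j} (u : Vec (Fin n) j) → u ∈ tuples j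
    ∈-tuples []      = here refl
    ∈-tuples (x ∷ u) = ∈ₚ.∈-cartesianProductWith⁺ _∷_ (∈ₚ.∈-allFin x) (∈-tuples u)

    pairs : List (Tuple n k × Tuple n k)
    pairs = List.cartesianProduct (tuples k) (tuples k)

    ∈-pairs : ∀ uv → uv ∈ pairs
    ∈-pairs (u , v) = ∈ₚ.∈-cartesianProduct⁺ (∈-tuples u) (∈-tuples v)

    noSplit? : ∀ r → U.Decidable (NoSplit r)
    noSplit? r (u , v) = sameColor? r u v →-dec sameColor? (suc r) u v

  stable? : ∀ r → Dec (Stable G k r)
  stable? r = map′ (λ p → noSplit⇒stable r (λ uv → All.lookup p (∈-pairs uv)))
                   (λ st → All.tabulate (λ {uv} _ → stable⇒noSplit st uv))
                   (All.all? (noSplit? r) pairs)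

  private
    same? : ∀ r → U.Decidable (uncurry (SameColor r))
    same? r (u , v) = sameColor? r u v

    count : ℕ → ℕ
    count r = length (List.filter (same? r) pairs)

    unstable⇒count-< : ∀ r → ¬ Stable G k r → count (suc r) < count r
    unstable⇒count-< r ¬st = filter-< (same? r) (same? (suc r)) (λ _ → proj₁) pairs
      (Any.map (λ {uv} → split uv) (All.¬All⇒Any¬ (noSplit? r) pairs
        (λ p → ¬st (noSplit⇒stable r (λ uv → All.lookup p (∈-pairs uv))))))
      where
      split : ∀ uv → ¬ NoSplit r uv → uncurry (SameColor r) uv × ¬ uncurry (SameColor (suc r)) uv
      split uv ¬p with same? r uv
      ... | yes c = c , λ c′ → ¬p (λ _ → c′)
      ... | no ¬c = ⊥-elim (¬p (⊥-elim ∘ ¬c))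

    -- Each unstable round separates a pair of tuples that had the same color, so the number of such
    -- pairs bounds the number of unstable rounds still to come.
    find : ∀ fuel r → count r ≤ fuel → ∃[ s ] Stable G k s
    find fuel r c≤fuel with stable? r
    ... | yes st = r , st
    find zero r c≤0 | no ¬st = ⊥-elim (ℕ.n≮0 (ℕ.≤-trans (unstable⇒count-< r ¬st) c≤0))
    find (suc fuel) r c≤1+fuel | no ¬st =
      find fuel (suc r) (ℕ.≤-pred (ℕ.≤-trans (unstable⇒count-< r ¬st) c≤1+fuel))

  -- A stable coloring separates no further pair, so a pair split at `s` but not at `r` excludes
  -- stability up to round `r`. A winning strategy of any length `s` for Spoiler will do.
  late-split⇒iterationNumber : ∀ {r s u v} → SameColor r u v → ¬ SameColor s u v →
    ∃[ t ] (IsIterationNumber G k t × r < t)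
  late-split⇒iterationNumber {r} {s} {u} {v} same split =
    let t , st , min = least stable? (proj₂ (find (count 0) 0 ℕ.≤-refl))
    in  t , (st , min) , ℕ.≰⇒> λ t≤r → split (stable⇒sameColor st (sameColor-≤ t≤r same) s)

-- Congruences and residues.

∣∧<⇒≡0 : ∀ {d n} → d ℕ.∣ n → n < d → n ≡ 0
∣∧<⇒≡0 {n = zero}  _   _   = refl
∣∧<⇒≡0 {n = suc n} d∣n n<d = contradiction d∣n (ℕ.>⇒∤ n<d)

module Congruence (m : ℕ) where
  infix 4 _≅_
  record _≅_ (a b : ℤ) : Set where
    constructor multiple
    field
      quotient : ℤ
      equality : a ≡ b + quotient * + m

  ≅-reflexive : ∀ {a b} → a ≡ b → a ≅ b
  ≅-reflexive {a} refl = multiple 0ℤ (lem a (+ m))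
    where
    lem : ∀ a m → a ≡ a + 0ℤ * m
    lem = solve-∀

  ≅-refl : ∀ {a} → a ≅ a
  ≅-refl = ≅-reflexive refl

  ≅-sym : ∀ {a b} → a ≅ b → b ≅ a
  ≅-sym {a} {b} (multiple q refl) = multiple (- q) (lem b q (+ m))
    where
    lem : ∀ b q m → b ≡ b + q * m + (- q) * m
    lem = solve-∀

  ≅-trans : ∀ {a b c} → a ≅ b → b ≅ c → a ≅ c
  ≅-trans {a} {b} {c} (multiple q refl) (multiple r refl) = multiple (q + r) (lem c q r (+ m))
    where
    lem : ∀ c q r m → c + r * m + q * m ≡ c + (q + r) * m
    lem = solve-∀

  +-cong : ∀ {a b c d} → a ≅ b → c ≅ d → a + c ≅ b + d
  +-cong {b = b} {d = d} (multiple q refl) (multiple r refl) = multiple (q + r) (lem b d q r (+ m))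
    where
    lem : ∀ b d q r m → (b + q * m) + (d + r * m) ≡ b + d + (q + r) * m
    lem = solve-∀

  +-cancelʳ : ∀ {a b} c → a + c ≅ b + c → a ≅ b
  +-cancelʳ {a} {b} c eq =
    ≅-trans (≅-reflexive (lem a c)) (≅-trans (+-cong eq (≅-refl { - c})) (≅-reflexive (sym (lem b c))))
    where
    lem : ∀ a c → a ≡ a + c + - c
    lem = solve-∀

  *-congˡ : ∀ {a b} c → a ≅ b → c * a ≅ c * b
  *-congˡ {b = b} c (multiple q refl) = multiple (c * q) (lem b c q (+ m))
    where
    lem : ∀ b c q m → c * (b + q * m) ≡ c * b + c * q * m
    lem = solve-∀

  ≅⇒∣ : ∀ {a} → a ≅ 0ℤ → m ℕ.∣ ∣ a ∣
  ≅⇒∣ {a} (multiple q refl) = ℕ.divides ∣ q ∣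
    (trans (cong ∣_∣ (ℤ.+-identityˡ (q * + m))) (ℤ.abs-* q (+ m)))

  ≅-small : ∀ {a b} → a ≅ b → ∣ a - b ∣ < m → a ≡ b
  ≅-small {a} {b} (multiple q eq) small = ℤ.i-j≡0⇒i≡j a b (ℤ.∣i∣≡0⇒i≡0 (∣∧<⇒≡0 (≅⇒∣ (multiple q diff)) small))
    where
    lem : ∀ b q m → b + q * m - b ≡ 0ℤ + q * m
    lem = solve-∀
    diff : a - b ≡ 0ℤ + q * + m
    diff = trans (cong (_- b) eq) (lem b q (+ m))

  ≅-toℕ : ∀ {x y} → x < m → y < m → + x ≅ + y → x ≡ y
  ≅-toℕ {x} {y} x<m y<m eq = ℤ.+-injective (≅-small eq
    (ℕ.≤-<-trans (subst (λ z → ∣ z ∣ ≤ x ℕ.⊔ y) (sym (ℤ.m-n≡m⊖n x y)) (ℤ.∣m⊝n∣≤m⊔n x y))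
                 (ℕ.⊔-lub x<m y<m)))

  residue : .{{_ : NonZero m}} → ℤ → Fin m
  residue z = fromℕ< (ℤ.n%ℕd<d z m)

  residue-≅ : .{{_ : NonZero m}} → ∀ z → + toℕ (residue z) ≅ z
  residue-≅ z = ≅-sym (multiple (z ℤ./ℕ m) (trans (ℤ.a≡a%ℕn+[a/ℕn]*n z m)
    (cong (λ r → + r + (z ℤ./ℕ m) * + m) (sym (Fin.toℕ-fromℕ< (ℤ.n%ℕd<d z m))))))

  toℕ-≅-injective : ∀ {i j : Fin m} → + toℕ i ≅ + toℕ j → i ≡ j
  toℕ-≅-injective {i} {j} eq = Fin.toℕ-injective (≅-toℕ (Fin.toℕ<n i) (Fin.toℕ<n j) eq)

  residue-cong : .{{_ : NonZero m}} → ∀ {a b} → a ≅ b → residue a ≡ residue b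
  residue-cong {a} {b} eq = toℕ-≅-injective (≅-trans (residue-≅ a) (≅-trans eq (≅-sym (residue-≅ b))))

  residue-injective : .{{_ : NonZero m}} → ∀ {a b} → residue a ≡ residue b → a ≅ b
  residue-injective {a} {b} eq = ≅-trans (≅-sym (residue-≅ a))
    (≅-trans (≅-reflexive (cong (λ r → + toℕ r) eq)) (residue-≅ b))

  residue-toℕ : .{{_ : NonZero m}} → ∀ i → residue (+ toℕ i) ≡ i
  residue-toℕ i = toℕ-≅-injective (residue-≅ (+ toℕ i))

  %-≅ : .{{_ : NonZero m}} → ∀ n → + (n ℕ.% m) ≅ + n
  %-≅ n = ≅-sym (multiple (+ n ℤ./ℕ m) (ℤ.a≡a%ℕn+[a/ℕn]*n (+ n) m))

  ≅⇒%≡ : .{{_ : NonZero m}} → ∀ {x y} → + x ≅ + y → x ℕ.% m ≡ y ℕ.% m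
  ≅⇒%≡ {x} {y} eq = ≅-toℕ (ℕ.m%n<n x m) (ℕ.m%n<n y m) (≅-trans (%-≅ x) (≅-trans eq (≅-sym (%-≅ y))))

  %≡⇒≅ : .{{_ : NonZero m}} → ∀ {x y} → x ℕ.% m ≡ y ℕ.% m → + x ≅ + y
  %≡⇒≅ {x} {y} eq = ≅-trans (≅-sym (%-≅ x)) (≅-trans (≅-reflexive (cong +_ eq)) (%-≅ y))

does-true⇒ : ∀ {A : Set} (a? : Dec A) → does a? ≡ true → A
does-true⇒ (yes a) _ = a

-- Finite sums of integers.

∑ : ∀ {n} → (Fin n → ℤ) → ℤ
∑ = sum ℤ.+-0-commutativeMonoid

∑-cong : ∀ {n} {f g : Fin n → ℤ} → f ≗ g → ∑ f ≡ ∑ g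
∑-cong = sum-cong-≗ ℤ.+-0-commutativeMonoid

∑-+ : ∀ {n} (f g : Fin n → ℤ) → ∑ (λ i → f i + g i) ≡ ∑ f + ∑ g
∑-+ = ∑-distrib-+ ℤ.+-0-commutativeMonoid

∑-0 : ∀ n → ∑ {n} (λ _ → 0ℤ) ≡ 0ℤ
∑-0 zero    = refl
∑-0 (suc n) = trans (ℤ.+-identityˡ _) (∑-0 n)

∑-≅ : ∀ m {n} {f g : Fin n → ℤ} → (∀ i → Congruence._≅_ m (f i) (g i)) → Congruence._≅_ m (∑ f) (∑ g)
∑-≅ m {zero}  eq = Congruence.≅-refl m
∑-≅ m {suc n} eq = Congruence.+-cong m (eq zero) (∑-≅ m (eq ∘ suc))

funToFin-cong : ∀ {m n} {f g : Fin m → Fin n} → f ≗ g → funToFin f ≡ funToFin g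
funToFin-cong {zero}  eq = refl
funToFin-cong {suc m} eq = cong₂ combine (eq zero) (funToFin-cong (eq ∘ suc))

-- Graphs of linear systems and the pebble game on them.

-- A vertex is an equation Σ coef · var = const over the D variables (ports) of a site, together
-- with values modulo M for these variables; its color names the site and the constant.
-- Vertices of different sites are adjacent when they agree on all shared variables.  The pads
-- are isolated vertices that only serve to reach a prescribed number of vertices.
module LinearGraph
  (B D M pads : ℕ) .{{_ : NonZero M}}
  (Var : Set) (_≟ᵛ_ : DecidableEquality Var)
  (var : Fin B → Fin D → Var) (coef : Fin B → Fin D → ℤ)
  where

  open Congruence M

  Code = Fin (M ℕ.^ D)
  Label = (Fin B × Code) ⊎ Fin pads

  size : ℕ
  size = B ℕ.* M ℕ.^ D ℕ.+ pads

  label : Fin size → Label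
  label v = Sum.map₁ (remQuot (M ℕ.^ D)) (splitAt (B ℕ.* M ℕ.^ D) v)

  vertex : Label → Fin size
  vertex (inj₁ (x , c)) = combine x c ↑ˡ pads
  vertex (inj₂ j)       = (B ℕ.* M ℕ.^ D) ↑ʳ j

  label-vertex : ∀ l → label (vertex l) ≡ l
  label-vertex (inj₁ (x , c))
    rewrite Fin.splitAt-↑ˡ (B ℕ.* M ℕ.^ D) (combine x c) pads = cong inj₁ (Fin.remQuot-combine x c)
  label-vertex (inj₂ j) rewrite Fin.splitAt-↑ʳ (B ℕ.* M ℕ.^ D) pads j = refl

  vertex-label : ∀ v → vertex (label v) ≡ v
  vertex-label v with splitAt (B ℕ.* M ℕ.^ D) v in eq
  ... | inj₁ w = trans (cong (_↑ˡ pads) (Fin.combine-remQuot {B} (M ℕ.^ D) w)) (Fin.splitAt⁻¹-↑ˡ eq)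
  ... | inj₂ j = Fin.splitAt⁻¹-↑ʳ eq

  label-injective : ∀ {v w} → label v ≡ label w → v ≡ w
  label-injective {v} {w} eq = trans (sym (vertex-label v)) (trans (cong vertex eq) (vertex-label w))

  values : Code → Fin D → ℤ
  values c p = + toℕ (finToFun c p)

  -- The left-hand side of the equation at site `x`, whose residue modulo `M` is recorded in the
  -- color.
  pin : Fin B → (Fin D → ℤ) → ℤ
  pin x f = ∑ (λ p → coef x p * f p)

  pin-≅ : ∀ x {f g : Fin D → ℤ} → (∀ p → f p ≅ g p) → pin x f ≅ pin x g
  pin-≅ x eq = ∑-≅ M (λ p → *-congˡ (coef x p) (eq p))

  pin-+ : ∀ x f g → pin x (λ p → f p + g p) ≡ pin x f + pin x g
  pin-+ x f g = trans (∑-cong (λ p → ℤ.*-distribˡ-+ (coef x p) (f p) (g p)))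
                      (∑-+ (λ p → coef x p * f p) (λ p → coef x p * g p))

  Compat : Fin B → Code → Fin B → Code → Set
  Compat x c y d = ∀ p q → var x p ≡ var y q → finToFun c p ≡ finToFun d q

  Adj : Label → Label → Set
  Adj (inj₁ (x , c)) (inj₁ (y , d)) = x ≢ y × Compat x c y d
  Adj (inj₁ _)       (inj₂ _)       = ⊥
  Adj (inj₂ _)       _              = ⊥

  adj? : ∀ l m → Dec (Adj l m)
  adj? (inj₁ (x , c)) (inj₁ (y , d)) = ¬? (x Fin.≟ y) ×-dec
    Fin.all? (λ p → Fin.all? (λ q → (var x p ≟ᵛ var y q) →-dec (finToFun c p Fin.≟ finToFun d q)))
  adj? (inj₁ _)       (inj₂ _)       = no λ ()
  adj? (inj₂ _)       _              = no λ ()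

  Adj-sym : ∀ l m → Adj l m → Adj m l
  Adj-sym (inj₁ _) (inj₁ _) (x≢y , comp) = x≢y ∘ sym , λ p q eq → sym (comp q p (sym eq))

  Adj-irrefl : ∀ l → ¬ Adj l l
  Adj-irrefl (inj₁ _) (x≢x , _) = x≢x refl

  labelColor : Label → ℕ
  labelColor (inj₁ (x , c)) = toℕ (combine x (residue (pin x (values c))))
  labelColor (inj₂ _)       = B ℕ.* M

  graph : ColoredGraph size
  graph = record
    { adj        = λ v w → does (adj? (label v) (label w))
    ; adj-sym    = λ v w → does-⇔ (mk⇔ (Adj-sym (label v) (label w)) (Adj-sym (label w) (label v)))
                                   (adj? (label v) (label w)) (adj? (label w) (label v))
    ; adj-irrefl = λ v → dec-false (adj? (label v) (label v)) (Adj-irrefl (label v))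
    ; color      = λ v → labelColor (label v)
    }

  shiftCode : (Fin D → ℤ) → Code → Code
  shiftCode t c = funToFin (λ p → residue (values c p + t p))

  finToFun-shiftCode : ∀ t c p → finToFun (shiftCode t c) p ≡ residue (values c p + t p)
  finToFun-shiftCode t c = Fin.finToFun-funToFin (λ p → residue (values c p + t p))

  values-shiftCode : ∀ t c p → values (shiftCode t c) p ≅ values c p + t p
  values-shiftCode t c p =
    ≅-trans (≅-reflexive (cong (λ i → + toℕ i) (finToFun-shiftCode t c p))) (residue-≅ _)

  shiftCode-cong : ∀ {t t′} → t ≗ t′ → ∀ c → shiftCode t c ≡ shiftCode t′ c
  shiftCode-cong eq c = funToFin-cong (λ p → cong (λ z → residue (values c p + z)) (eq p))

  shiftCode-inverse : ∀ {t t′} → (∀ p → t p + t′ p ≡ 0ℤ) → ∀ c → shiftCode t′ (shiftCode t c) ≡ c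
  shiftCode-inverse {t} {t′} eq c = trans
    (funToFin-cong λ p → trans
      (residue-cong (≅-trans (+-cong (values-shiftCode t c p) (≅-refl {t′ p}))
        (≅-reflexive (trans (ℤ.+-assoc (values c p) (t p) (t′ p))
          (trans (cong (_+_ (values c p)) (eq p)) (ℤ.+-identityʳ (values c p)))))))
      (residue-toℕ (finToFun c p)))
    (Fin.funToFin-finToFin {D} c)

  shift : (Fin B → Fin D → ℤ) → Label → Label
  shift t (inj₁ (x , c)) = inj₁ (x , shiftCode (t x) c)
  shift t (inj₂ j)       = inj₂ j

  shift-inverse : ∀ {t t′} → (∀ x p → t x p + t′ x p ≡ 0ℤ) → ∀ l → shift t′ (shift t l) ≡ l
  shift-inverse {t} {t′} eq (inj₁ (x , c)) = cong (λ d → inj₁ (x , d)) (shiftCode-inverse {t x} {t′ x} (eq x) c)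
  shift-inverse eq (inj₂ j)       = refl

  shiftPerm : (Fin B → Fin D → ℤ) → Perm.Permutation size size
  shiftPerm t = Perm.permutation (vertex ∘ shift t ∘ label) (vertex ∘ shift t⁻ ∘ label)
    (inv t⁻ t (λ x p → ℤ.+-inverseˡ (t x p))) (inv t t⁻ (λ x p → ℤ.+-inverseʳ (t x p)))
    where
    t⁻ : Fin B → Fin D → ℤ
    t⁻ x p = - t x p
    inv : ∀ t t′ → (∀ x p → t x p + t′ x p ≡ 0ℤ) →
          ∀ v → vertex (shift t′ (label (vertex (shift t (label v))))) ≡ v
    inv t t′ eq v rewrite label-vertex (shift t (label v)) | shift-inverse {t} {t′} eq (label v) = vertex-label v

  module _ (s : Var → ℤ) where

    along : Fin B → Fin D → ℤ
    along x p = s (var x p)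

    -- Both copies of a shared variable move by the same amount, so every assignment preserves
    -- adjacency; the equations enter only through the colors.
    compat-along : ∀ x c y d → Compat x c y d ⇔ Compat x (shiftCode (along x) c) y (shiftCode (along y) d)
    compat-along x c y d = mk⇔
      (λ comp p q eq → trans (finToFun-shiftCode (along x) c p) (trans
        (cong residue (cong₂ _+_ (cong (λ i → + toℕ i) (comp p q eq)) (cong s eq)))
        (sym (finToFun-shiftCode (along y) d q))))
      (λ comp p q eq → toℕ-≅-injective (+-cancelʳ (along x p) (≅-trans
        (residue-injective (trans (sym (finToFun-shiftCode (along x) c p))
          (trans (comp p q eq) (finToFun-shiftCode (along y) d q))))
        (≅-reflexive (cong (λ z → values d q + z) (cong s (sym eq)))))))

    adj-along : ∀ l m → Adj l m ⇔ Adj (shift along l) (shift along m)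
    adj-along (inj₁ (x , c)) (inj₁ (y , d)) =
      mk⇔ (λ (x≢y , comp) → x≢y , Equivalence.to (compat-along x c y d) comp)
          (λ (x≢y , comp) → x≢y , Equivalence.from (compat-along x c y d) comp)
    adj-along (inj₁ _) (inj₂ _) = mk⇔ id id
    adj-along (inj₂ _) _        = mk⇔ id id

  Place : Set
  Place = Maybe (Fin B)

  place : Label → Place
  place (inj₁ (x , _)) = just x
  place (inj₂ _)       = nothing

  -- Homogeneous, since a shift must keep the constant in the color of every vertex. The equation
  -- holds over the integers, which implies the congruence that colors test.
  Satisfies : (Var → ℤ) → Place → Set
  Satisfies s (just x) = pin x (along s x) ≡ 0ℤ
  Satisfies s nothing  = ⊤

  Agree : (Var → ℤ) → (Var → ℤ) → Place → Set
  Agree s t (just x) = ∀ p → s (var x p) ≡ t (var x p)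
  Agree s t nothing  = ⊤

  labelColor-along : ∀ s l → Satisfies s (place l) → labelColor (shift (along s) l) ≡ labelColor l
  labelColor-along s (inj₁ (x , c)) sat = cong (toℕ ∘ combine x) (residue-cong
    (≅-trans (pin-≅ x (values-shiftCode (along s x) c)) (≅-reflexive
      (trans (pin-+ x (values c) (along s x)) (trans (cong (_+_ (pin x (values c))) sat) (ℤ.+-identityʳ (pin x (values c))))))))
  labelColor-along s (inj₂ _) sat = refl

  shift-agree : ∀ {s t} l → Agree s t (place l) → shift (along s) l ≡ shift (along t) l
  shift-agree (inj₁ (x , c)) eq = cong (λ d → inj₁ (x , d)) (shiftCode-cong eq c)
  shift-agree (inj₂ _)       eq = refl

  module _ {k : ℕ} where

    -- Duplicator answers a move to place y with the shift along t; she may pick a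
    -- different assignment tᵢ afterwards for each pebble i that Spoiler gives up.
    Wins : ℕ → (Fin k → Place) → (Var → ℤ) → Set
    Wins zero    P s = ∀ i → Satisfies s (P i)
    Wins (suc r) P s = Wins r P s × (∀ y → ∃[ t ] (∀ i → ∃[ tᵢ ]
      (Agree t tᵢ y × (∀ j → j ≢ i → Agree s tᵢ (P j)) ×
       (∀ P′ → P′ i ≡ y → (∀ j → j ≢ i → P′ j ≡ P j) → Wins r P′ tᵢ))))

    Shifted : (Fin k → Place) → (Var → ℤ) → Tuple size k → Tuple size k → Set
    Shifted P s u v = ∀ i → place (label (lookup u i)) ≡ P i ×
                            label (lookup v i) ≡ shift (along s) (label (lookup u i))

    shifted⇒definesIso : ∀ {P s u v} → Wins 0 P s → Shifted P s u v → DefinesIso graph u v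
    shifted⇒definesIso {P} {s} {u} {v} sat sh = record
      { well-defined    = λ i j eq → label-injective (trans (proj₂ (sh i))
          (trans (cong (shift (along s) ∘ label) eq) (sym (proj₂ (sh j)))))
      ; injective       = λ i j eq → label-injective (trans (sym (back i))
          (trans (cong (shift (λ x p → - along s x p) ∘ label) eq) (back j)))
      ; preserves-adj   = λ i j → trans
          (does-⇔ (adj-along s (lab u i) (lab u j)) (adj? (lab u i) (lab u j))
            (adj? (shift (along s) (lab u i)) (shift (along s) (lab u j))))
          (cong₂ (λ l m → does (adj? l m)) (sym (proj₂ (sh i))) (sym (proj₂ (sh j))))
      ; preserves-color = λ i → trans
          (sym (labelColor-along s (lab u i) (subst (Satisfies s) (sym (proj₁ (sh i))) (sat i))))
          (cong labelColor (sym (proj₂ (sh i))))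
      }
      where
      lab : Tuple size k → Fin k → Label
      lab w i = label (lookup w i)
      back : ∀ i → shift (λ x p → - along s x p) (lab v i) ≡ lab u i
      back i = trans (cong (shift (λ x p → - along s x p)) (proj₂ (sh i)))
        (shift-inverse (λ x p → ℤ.+-inverseʳ (along s x p)) (lab u i))

    wins⇒sameColor : ∀ r {P s u v} → Wins r P s → Shifted P s u v → SameColor graph k r u v
    wins⇒sameColor zero    win sh = shifted⇒definesIso win sh
    wins⇒sameColor (suc r) {P} {s} {u} {v} (win , answer) sh =
      sameColor-suc graph k r (wins⇒sameColor r win sh) (shiftPerm t) next
      where
      t : Fin B → Fin D → ℤ
      -- A single permutation is assembled from the answers for all sites: the vertices of each site
      -- move along the assignment chosen for that site.
      t x = along (proj₁ (answer (just x))) x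

      next : ∀ w i → SameColor graph k r (u [ i ]≔ w) (v [ i ]≔ (shiftPerm t ⟨$⟩ʳ w))
      next w i =
        let tᵢ , agree-y , agree , win′ = proj₂ (answer y) i
        in  wins⇒sameColor r (win′ P′ P′-new P′-old) (sh′ tᵢ agree-y agree)
        where
        y : Place
        y = place (label w)
        P′ : Fin k → Place
        P′ j = place (label (lookup (u [ i ]≔ w) j))
        P′-new : P′ i ≡ y
        P′-new = cong (place ∘ label) (Vec.lookup∘update i u w)
        P′-old : ∀ j → j ≢ i → P′ j ≡ P j
        P′-old j j≢i = trans (cong (place ∘ label) (Vec.lookup∘update′ j≢i u w)) (proj₁ (sh j))
        shift-t : ∀ l → shift t l ≡ shift (along (proj₁ (answer (place l)))) l
        shift-t (inj₁ _) = refl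
        shift-t (inj₂ _) = refl
        sh′ : ∀ tᵢ → Agree (proj₁ (answer y)) tᵢ y → (∀ j → j ≢ i → Agree s tᵢ (P j)) →
              Shifted P′ tᵢ (u [ i ]≔ w) (v [ i ]≔ (shiftPerm t ⟨$⟩ʳ w))
        sh′ tᵢ agree-y agree j with j Fin.≟ i
        ... | yes refl = refl , trans (cong label (Vec.lookup∘update j v _))
              (trans (label-vertex (shift t (label w))) (trans (shift-t (label w))
                (trans (shift-agree (label w) agree-y)
                  (cong (shift (along tᵢ) ∘ label) (sym (Vec.lookup∘update j u w))))))
        ... | no j≢i = refl , trans (cong label (Vec.lookup∘update′ j≢i v _))
              (trans (proj₂ (sh j)) (trans
                (shift-agree (label (lookup u j)) (subst (Agree s tᵢ) (sym (proj₁ (sh j))) (agree j j≢i)))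
                (cong (shift (along tᵢ) ∘ label) (sym (Vec.lookup∘update′ j≢i u w)))))

  zeros : Code
  zeros = funToFin {D} (λ _ → residue 0ℤ)

  origin : Fin B → Fin size
  origin x = vertex (inj₁ (x , zeros))

  reading : Label → Fin D → ℤ
  reading (inj₁ (_ , c)) = values c
  reading (inj₂ _)       = λ _ → 0ℤ

  module _ {k : ℕ} where

    origins : Vec (Fin B) k → Tuple size k
    origins = Vec.map origin

    read : Tuple size k → Fin k → Fin D → ℤ
    read v i = reading (label (lookup v i))

    module _ {Q : Vec (Fin B) k} {v : Tuple size k} (iso : DefinesIso graph (origins Q) v) where
      private
        label-origin : ∀ i → label (lookup (origins Q) i) ≡ inj₁ (lookup Q i , zeros)
        label-origin i = trans (cong label (Vec.lookup-map i origin Q)) (label-vertex (inj₁ (lookup Q i , zeros)))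

        labelColor⇒site : ∀ x l → labelColor (inj₁ (x , zeros)) ≡ labelColor l →
          ∃[ c ] (l ≡ inj₁ (x , c) × pin x (values c) ≅ 0ℤ)
        -- Pads have color `B * M`, which exceeds the colors of all sites.
        labelColor⇒site x (inj₂ _) eq =
          ⊥-elim (ℕ.<-irrefl eq (Fin.toℕ<n (combine x (residue (pin x (values zeros))))))
        labelColor⇒site x (inj₁ (y , c)) eq
          with Fin.combine-injective x _ y _ (Fin.toℕ-injective eq)
        ... | refl , eq′ = c , refl , ≅-trans (≅-sym (residue-injective eq′)) (≅-trans
          (pin-≅ x {g = λ _ → 0ℤ} (λ p → ≅-trans
            (≅-reflexive (cong (λ i → + toℕ i) (Fin.finToFun-funToFin {D} (λ _ → residue 0ℤ) p)))
            (residue-≅ 0ℤ)))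
          (≅-reflexive (trans (∑-cong (λ p → ℤ.*-zeroʳ (coef x p))) (∑-0 D))))

        site : ∀ i → ∃[ c ] (label (lookup v i) ≡ inj₁ (lookup Q i , c) × pin (lookup Q i) (values c) ≅ 0ℤ)
        site i = labelColor⇒site (lookup Q i) (label (lookup v i))
          (trans (cong labelColor (sym (label-origin i))) (DefinesIso.preserves-color iso i))

      read-pin : ∀ i → pin (lookup Q i) (read v i) ≅ 0ℤ
      read-pin i with c , eq , sat ← site i rewrite eq = sat

      -- Origins at distinct sites are adjacent because all their values are 0. The isomorphism
      -- carries this adjacency over to `v`, where it forces shared variables to have equal values.
      read-compat : ∀ i j → lookup Q i ≢ lookup Q j → ∀ p q → var (lookup Q i) p ≡ var (lookup Q j) q →
                    read v i p ≡ read v j q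
      read-compat i j x≢y p q eq
        with c , eqᵢ , _ ← site i | d , eqⱼ , _ ← site j
        with adjacent ← DefinesIso.preserves-adj iso i j
        rewrite label-origin i | label-origin j | eqᵢ | eqⱼ =
        cong (λ i → + toℕ i) (proj₂ (does-true⇒ (adj? _ _) (trans (sym adjacent)
          (dec-true (adj? _ _) (x≢y , λ p q _ → trans
            (Fin.finToFun-funToFin {D} (λ _ → residue 0ℤ) p)
            (sym (Fin.finToFun-funToFin {D} (λ _ → residue 0ℤ) q)))))) p q eq)

    Alike : ℕ → Vec (Fin B) k → Tuple size k → Set
    Alike r Q v = SameColor graph k r (origins Q) v

    alike⇒iso : ∀ r {Q v} → Alike r Q v → DefinesIso graph (origins Q) v
    alike⇒iso r = sameColor-≤ graph k {s = r} z≤n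

    alike-move : ∀ r {Q v} → Alike (suc r) Q v → ∀ y → ∃[ w ] (∀ i → Alike r (Q [ i ]≔ y) (v [ i ]≔ w))
    alike-move r {Q} {v} al y =
      let σ , eq = sameColor-next graph k r al
      in  σ ⟨$⟩ʳ origin y , λ i → subst (λ u → SameColor graph k r u (v [ i ]≔ (σ ⟨$⟩ʳ origin y)))
            (sym (Vec.map-[]≔ origin Q i)) (eq (origin y) i)

    module _ r {Q : Vec (Fin B) k} {v : Tuple size k} {y w}
             (alike : ∀ i → Alike r (Q [ i ]≔ y) (v [ i ]≔ w)) where

      move-pin : Fin k → pin y (reading (label w)) ≅ 0ℤ
      move-pin i = subst₂ (λ x u → pin x (reading (label u)) ≅ 0ℤ)
        (Vec.lookup∘update i Q y) (Vec.lookup∘update i v w) (read-pin (alike⇒iso r (alike i)) i)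

      move-compat : ∀ {i j} → i ≢ j → y ≢ lookup Q j → ∀ p q → var y p ≡ var (lookup Q j) q →
                    reading (label w) p ≡ read v j q
      move-compat {i} {j} i≢j y≢x p q eq = begin
        reading (label w) p        ≡⟨ cong (λ u → reading (label u) p) wᵢ ⟨
        read (v [ i ]≔ w) i p      ≡⟨ read-compat (alike⇒iso r (alike i)) i j
                                        (λ e → y≢x (trans (sym yᵢ) (trans e xⱼ))) p q
                                        (trans (cong (λ x → var x p) yᵢ) (trans eq (cong (λ x → var x q) (sym xⱼ)))) ⟩
        read (v [ i ]≔ w) j q      ≡⟨ cong (λ u → reading (label u) q) (Vec.lookup∘update′ (i≢j ∘ sym) v w) ⟩
        read v j q                 ∎
        where
        open ≡-Reasoning
        wᵢ = Vec.lookup∘update i v w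
        yᵢ = Vec.lookup∘update i Q y
        xⱼ = Vec.lookup∘update′ (i≢j ∘ sym) Q y

    -- Spoiler trades the pebbles on Q for pebbles on Q′ one at a time; the variable that
    -- the new place shares with the old one keeps its value.
    alike-replace : ∀ r {Q Q′ v} (out inp : Fin k → Fin D) →
      (∀ i → ∃[ j ] j ≢ i) →
      (∀ i → lookup Q i ≢ lookup Q′ i) →
      (∀ i → var (lookup Q i) (out i) ≡ var (lookup Q′ i) (inp i)) →
      Alike (k ℕ.+ r) Q v →
      ∃[ v′ ] (Alike r Q′ v′ × (∀ i → read v′ i (inp i) ≡ read v i (out i)))
    alike-replace r {Q} {Q′} {v} out inp other Q≢Q′ shared al =
      go k ℕ.≤-refl al (λ i → inj₂ (Fin.toℕ<n i , refl , refl))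
      where
      New Old : Vec (Fin B) k → Tuple size k → Fin k → Set
      New R w i = lookup R i ≡ lookup Q′ i × read w i (inp i) ≡ read v i (out i)
      Old R w i = lookup R i ≡ lookup Q i × read w i (out i) ≡ read v i (out i)

      Mixed : ℕ → Vec (Fin B) k → Tuple size k → Set
      Mixed d R w = ∀ i → (d ≤ toℕ i × New R w i) ⊎ (toℕ i < d × Old R w i)

      go : ∀ d → d ≤ k → ∀ {R w} → Alike (d ℕ.+ r) R w → Mixed d R w →
           ∃[ v′ ] (Alike r Q′ v′ × (∀ i → read v′ i (inp i) ≡ read v i (out i)))
      go zero _ {R} {w} alike mixed = w , subst (λ R → Alike r R w) R≡Q′ alike , λ i → proj₂ (new i)
        where
        new : ∀ i → New R w i
        new i with mixed i
        ... | inj₁ (_ , n) = n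
        R≡Q′ : R ≡ Q′
        R≡Q′ = trans (sym (Vec.tabulate∘lookup R))
          (trans (Vec.tabulate-cong (λ i → proj₁ (new i))) (Vec.tabulate∘lookup Q′))
      go (suc d) d<k {R} {w} alike mixed =
        let w′ , alike′ = alike-move (d ℕ.+ r) alike (lookup Q′ i)
        in  go d (ℕ.<⇒≤ d<k) (alike′ i) (mixed′ w′ alike′)
        where
        i : Fin k
        i = fromℕ< d<k
        toℕ-i : toℕ i ≡ d
        toℕ-i = Fin.toℕ-fromℕ< d<k
        old : Old R w i
        old with mixed i
        ... | inj₁ (d<i , _) = ⊥-elim (ℕ.<-irrefl (sym toℕ-i) d<i)
        ... | inj₂ (_ , o)   = o
        mixed′ : ∀ w′ → (∀ l → Alike (d ℕ.+ r) (R [ l ]≔ lookup Q′ i) (w [ l ]≔ w′)) →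
                 Mixed d (R [ i ]≔ lookup Q′ i) (w [ i ]≔ w′)
        mixed′ w′ alike′ l with l Fin.≟ i
        ... | yes refl = inj₁ (ℕ.≤-reflexive (sym toℕ-i) , Vec.lookup∘update l R (lookup Q′ l) , trans
              (cong (λ u → reading (label u) (inp l)) (Vec.lookup∘update l w w′))
              -- The answer `w′` is the same whichever pebble is lifted. Lifting a different one
              -- keeps pebble `l` on the board, so that the new vertex can be compared with it.
              (trans (move-compat (d ℕ.+ r) alike′ (proj₂ (other l))
                       (λ eq → Q≢Q′ l (sym (trans eq (proj₁ old)))) (inp l) (out l)
                       (trans (sym (shared l)) (cong (λ x → var x (out l)) (sym (proj₁ old)))))
                     (proj₂ old)))
        ... | no l≢i with mixed l
        ...   | inj₁ (d<l , n₁ , n₂) = inj₁ (ℕ.<⇒≤ d<l , trans (Vec.lookup∘update′ l≢i R _) n₁ ,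
                  trans (cong (λ x → reading (label x) (inp l)) (Vec.lookup∘update′ l≢i w w′)) n₂)
        ...   | inj₂ (l<1+d , o₁ , o₂) = inj₂
                  (ℕ.≤∧≢⇒< (ℕ.≤-pred l<1+d) (λ l≡d → l≢i (Fin.toℕ-injective (trans l≡d (sym toℕ-i)))) ,
                  trans (Vec.lookup∘update′ l≢i R _) o₁ ,
                  trans (cong (λ x → reading (label x) (out l)) (Vec.lookup∘update′ l≢i w w′)) o₂)

-- More sums, cyclic indices, and products of coprime numbers.

∑-zero : ∀ {n} {f : Fin n → ℤ} → (∀ i → f i ≡ 0ℤ) → ∑ f ≡ 0ℤ
∑-zero {n} eq = trans (∑-cong eq) (∑-0 n)

∑-neg : ∀ {n} (f : Fin n → ℤ) → ∑ (λ i → - f i) ≡ - ∑ f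
∑-neg {zero}  f = refl
∑-neg {suc n} f = trans (cong (_+_ (- f zero)) (∑-neg (f ∘ suc))) (sym (ℤ.neg-distrib-+ (f zero) (∑ (f ∘ suc))))

∑-difference : ∀ {n} (f g : Fin n → ℤ) → ∑ (λ i → f i - g i) ≡ ∑ f - ∑ g
∑-difference f g = trans (∑-+ f (λ i → - g i)) (cong (_+_ (∑ f)) (∑-neg g))

∑-*ʳ : ∀ {n} (f : Fin n → ℤ) z → ∑ (λ i → f i * z) ≡ ∑ f * z
∑-*ʳ {zero}  f z = refl
∑-*ʳ {suc n} f z = trans (cong (_+_ (f zero * z)) (∑-*ʳ (f ∘ suc) z)) (sym (ℤ.*-distribʳ-+ z (f zero) (∑ (f ∘ suc))))

∑-single : ∀ {n} (f : Fin n → ℤ) l → (∀ i → i ≢ l → f i ≡ 0ℤ) → ∑ f ≡ f l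
∑-single f zero    eq = trans (cong (_+_ (f zero)) (∑-zero (λ i → eq (suc i) λ ()))) (ℤ.+-identityʳ (f zero))
∑-single f (suc l) eq = trans (cong₂ _+_ (eq zero λ ()) (∑-single (f ∘ suc) l (λ i i≢l → eq (suc i) (i≢l ∘ Fin.suc-injective))))
  (ℤ.+-identityˡ (f (suc l)))

∑-bounded : ∀ {n} (f : Fin n → ℤ) → (∀ i → ∣ f i ∣ ≤ 1) → ∣ ∑ f ∣ ≤ n
∑-bounded {zero}  f f≤1 = z≤n
∑-bounded {suc n} f f≤1 = ℕ.≤-trans (ℤ.∣i+j∣≤∣i∣+∣j∣ (f zero) (∑ (f ∘ suc)))
  (ℕ.+-mono-≤ (f≤1 zero) (∑-bounded (f ∘ suc) (f≤1 ∘ suc)))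

[_≡?_] : ∀ {n} → Fin n → Fin n → ℤ
[ i ≡? j ] with i Fin.≟ j
... | yes _ = 1ℤ
... | no _  = 0ℤ

[≡] : ∀ {n} (i : Fin n) → [ i ≡? i ] ≡ 1ℤ
[≡] i with i Fin.≟ i
... | yes _  = refl
... | no i≢i = ⊥-elim (i≢i refl)

[≢] : ∀ {n} {i j : Fin n} → i ≢ j → [ i ≡? j ] ≡ 0ℤ
[≢] {i = i} {j} i≢j with i Fin.≟ j
... | yes i≡j = ⊥-elim (i≢j i≡j)
... | no _    = refl

∑-[] : ∀ {n} (l : Fin n) z → ∑ (λ i → [ i ≡? l ] * z) ≡ z
∑-[] l z = trans (∑-single (λ i → [ i ≡? l ] * z) l (λ i i≢l → cong (_* z) ([≢] i≢l)))
  (trans (cong (_* z) ([≡] l)) (ℤ.*-identityˡ z))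

module Cycle (k : ℕ) .{{_ : NonZero k}} where
  open Congruence k

  next prev : Fin k → Fin k
  next i = residue (+ toℕ i + 1ℤ)
  prev i = residue (+ toℕ i - 1ℤ)

  private
    lem₁ : ∀ z → z + 1ℤ - 1ℤ ≡ z
    lem₁ = solve-∀
    lem₂ : ∀ z → z - 1ℤ + 1ℤ ≡ z
    lem₂ = solve-∀

  prev-next : ∀ i → prev (next i) ≡ i
  prev-next i = trans (residue-cong (≅-trans (+-cong (residue-≅ (+ toℕ i + 1ℤ)) (≅-refl { - 1ℤ}))
    (≅-reflexive (lem₁ (+ toℕ i))))) (residue-toℕ i)

  next-prev : ∀ i → next (prev i) ≡ i
  next-prev i = trans (residue-cong (≅-trans (+-cong (residue-≅ (+ toℕ i - 1ℤ)) (≅-refl {1ℤ}))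
    (≅-reflexive (lem₂ (+ toℕ i))))) (residue-toℕ i)

  ∑-next : ∀ f → ∑ (f ∘ next) ≡ ∑ f
  ∑-next f = sym (sum-permute ℤ.+-0-commutativeMonoid f (Perm.permutation next prev next-prev prev-next))

  next≢ : 2 ≤ k → ∀ i → next i ≢ i
  next≢ 2≤k i eq = ℕ.<-irrefl (sym (∣∧<⇒≡0 (≅⇒∣ {1ℤ} (+-cancelʳ (+ toℕ i)
    (≅-trans (≅-reflexive (ℤ.+-comm 1ℤ (+ toℕ i)))
      (≅-trans (≅-sym (residue-≅ (+ toℕ i + 1ℤ)))
        (≅-reflexive (trans (cong (λ j → + toℕ j) eq) (sym (ℤ.+-identityˡ (+ toℕ i))))))))) 2≤k)) (s≤s z≤n)

  prev≢ : 2 ≤ k → ∀ i → prev i ≢ i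
  prev≢ 2≤k i eq = next≢ 2≤k i (trans (cong next (sym eq)) (next-prev i))

  toℕ-next : ∀ i → suc (toℕ i) < k → toℕ (next i) ≡ suc (toℕ i)
  toℕ-next i i+1<k = ≅-toℕ (Fin.toℕ<n (next i)) i+1<k
    (≅-trans (residue-≅ (+ toℕ i + 1ℤ)) (≅-reflexive (ℤ.+-comm (+ toℕ i) 1ℤ)))

  constant : ∀ {A : Set} (f : Fin k → A) → (∀ i → f (next i) ≡ f i) → ∀ i j → f i ≡ f j
  constant f eq i j = trans (go _ i refl) (sym (go _ j refl))
    where
    i₀ : Fin k
    i₀ = fromℕ< (ℕ.>-nonZero⁻¹ k)
    go : ∀ d i → toℕ i ≡ d → f i ≡ f i₀
    go zero i d≡ = cong f (Fin.toℕ-injective (trans d≡ (sym (Fin.toℕ-fromℕ< (ℕ.>-nonZero⁻¹ k)))))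
    go (suc d) i d≡ = trans (cong f (Fin.toℕ-injective (sym toℕ-next-j))) (trans (eq j′) (go d j′ toℕ-j))
      where
      d+1<k : suc d < k
      d+1<k = subst (_< k) d≡ (Fin.toℕ<n i)
      j′ : Fin k
      j′ = fromℕ< (ℕ.<-trans (ℕ.n<1+n d) d+1<k)
      toℕ-j : toℕ j′ ≡ d
      toℕ-j = Fin.toℕ-fromℕ< _
      toℕ-next-j : toℕ (next j′) ≡ toℕ i
      toℕ-next-j = trans (toℕ-next j′ (subst (λ x → suc x < k) (sym toℕ-j) d+1<k)) (trans (cong suc toℕ-j) (sym d≡))

∏ : ∀ {n} → (Fin n → ℕ) → ℕ
∏ {zero}  f = 1
∏ {suc n} f = f zero ℕ.* ∏ (f ∘ suc)

∣-∏ : ∀ {n} (f : Fin n → ℕ) i → f i ℕ.∣ ∏ f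
∣-∏ f zero    = ℕ.m∣m*n (∏ (f ∘ suc))
∣-∏ f (suc i) = ℕ.∣n⇒∣m*n (f zero) (∣-∏ (f ∘ suc) i)

coprime-* : ∀ {m n o} → Coprime m n → Coprime m o → Coprime m (n ℕ.* o)
coprime-* {m} {n} {o} cn co {d} (d∣m , d∣no) =
  co (d∣m , Coprime.coprime-divisor {d} {n} {o} (λ (e∣d , e∣n) → cn (ℕ.∣-trans e∣d d∣m , e∣n)) d∣no)

coprime-∏ : ∀ {n} m (f : Fin n → ℕ) → (∀ i → Coprime m (f i)) → Coprime m (∏ f)
coprime-∏ {zero}  m f cop (_ , d∣1) = ℕ.∣1⇒≡1 d∣1
coprime-∏ {suc n} m f cop = coprime-* (cop zero) (coprime-∏ m (f ∘ suc) (cop ∘ suc))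

∏-∣ : ∀ {n} (f : Fin n → ℕ) → (∀ {i j} → i ≢ j → Coprime (f i) (f j)) →
      ∀ {m} → (∀ i → f i ℕ.∣ m) → ∏ f ℕ.∣ m
∏-∣ {zero}  f cop {m} div = ℕ.1∣ m
∏-∣ {suc n} f cop {m} div with ℕ.divides q eq ← div zero =
  subst (∏ f ℕ.∣_) (sym (trans eq (ℕ.*-comm q (f zero))))
    (ℕ.*-monoʳ-∣ (f zero) (∏-∣ (f ∘ suc) (λ i≢j → cop (i≢j ∘ Fin.suc-injective)) (λ i →
      Coprime.coprime-divisor (Coprime.sym (cop {zero} {suc i} λ ()))
        (subst (f (suc i) ℕ.∣_) (trans eq (ℕ.*-comm q (f zero))) (div (suc i))))))

∏-≥ : ∀ {n} (f : Fin n → ℕ) z → (∀ i → z ≤ f i) → z ℕ.^ n ≤ ∏ f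
∏-≥ {zero}  f z z≤f = ℕ.≤-refl
∏-≥ {suc n} f z z≤f = ℕ.*-mono-≤ (z≤f zero) (∏-≥ (f ∘ suc) z (z≤f ∘ suc))

suc-% : ∀ c m .{{_ : NonZero m}} → suc (c ℕ.% m) ℕ.% m ≡ suc c ℕ.% m
suc-% c m = ≅⇒%≡ (+-cong (≅-refl {1ℤ}) (%-≅ c))
  where open Congruence m

factor-of-! : ∀ k z → z ≢ 0ℤ → ∣ z ∣ ≤ k → ∃[ h ] z * h ≡ - (+ (k !))
factor-of-! k (+ zero)  z≢0 _ = ⊥-elim (z≢0 refl)
factor-of-! k (+ suc n) _ n<k with ℕ.divides q eq ← ℕ.∣-trans (ℕ.m∣m*n {suc n} (n !)) (ℕ.m≤n⇒m!∣n! n<k) =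
  - + q , trans (sym (ℤ.neg-distribʳ-* (+ suc n) (+ q)))
    (cong -_ (trans (sym (ℤ.pos-* (suc n) q)) (cong +_ (trans (ℕ.*-comm (suc n) q) (sym eq)))))
factor-of-! k -[1+ n ]  _ n<k with ℕ.divides q eq ← ℕ.∣-trans (ℕ.m∣m*n {suc n} (n !)) (ℕ.m≤n⇒m!∣n! n<k) =
  + q , trans (sym (ℤ.neg-distribˡ-* (+ suc n) (+ q)))
    (cong -_ (trans (sym (ℤ.pos-* (suc n) q)) (cong +_ (trans (ℕ.*-comm (suc n) q) (sym eq)))))

-- One residue coordinate: the cross edges between two neighbouring rows.

module Profile (q : ℕ) (3≤q : 3 ≤ q) where

  private instance
    q-nonZero : NonZero q
    q-nonZero = ℕ.>-nonZero (ℕ.≤-trans (s≤s z≤n) 3≤q)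

  open Congruence q

  S : ℕ → ℕ
  S z = suc z ℕ.% q

  S-≅ : ∀ z → + S z ≅ 1ℤ + + z
  S-≅ z = %-≅ (suc z)

  S-injective : ∀ {y z} → y < q → z < q → S y ≡ S z → y ≡ z
  S-injective {y} {z} y<q z<q eq = ≅-toℕ y<q z<q (+-cancelʳ 1ℤ
    (subst₂ _≅_ (ℤ.+-comm 1ℤ (+ y)) (ℤ.+-comm 1ℤ (+ z)) (%≡⇒≅ eq)))

  ≅-≢ : ∀ {n z} → 1 ≤ n → n < 3 → ¬ (+ n + z ≅ z)
  ≅-≢ {n} {z} 1≤n n<3 eq = ℕ.<-irrefl (sym (∣∧<⇒≡0 (≅⇒∣ {+ n} (+-cancelʳ z
    (≅-trans eq (≅-reflexive (sym (ℤ.+-identityˡ z)))))) (ℕ.<-≤-trans n<3 3≤q))) 1≤n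

  S≢ : ∀ z → S z ≢ z
  S≢ z eq = ≅-≢ {1} {+ z} (s≤s z≤n) (s≤s (s≤s z≤n)) (≅-trans (≅-sym (S-≅ z)) (≅-reflexive (cong +_ eq)))

  SS≢ : ∀ z → S (S z) ≢ z
  SS≢ z eq = ≅-≢ {2} {+ z} (s≤s z≤n) (s≤s (s≤s (s≤s z≤n))) (≅-trans (≅-sym
    (≅-trans (S-≅ (S z)) (+-cong (≅-refl {1ℤ}) (S-≅ z)))) (≅-reflexive (cong +_ eq)))

  -- `A` and `B` are the residues at which the pebbles of two neighbouring rows see the cross edges
  -- between these rows. For residues below `q`, they are aligned exactly when the sets `A`, `S A`
  -- and `B`, `S B` of adjacent faces meet.
  data Aligned (A B : ℕ) : Set where
    level  : B ≡ A → Aligned A B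
    ahead  : B ≡ S A → Aligned A B
    behind : A ≡ S B → Aligned A B

  aligned? : ∀ A B → Dec (Aligned A B)
  aligned? A B with B ℕ.≟ A | B ℕ.≟ S A | A ℕ.≟ S B
  ... | yes eq | _      | _      = yes (level eq)
  ... | no _   | yes eq | _      = yes (ahead eq)
  ... | no _   | no _   | yes eq = yes (behind eq)
  ... | no ≢₁  | no ≢₂  | no ≢₃  = no λ { (level eq) → ≢₁ eq ; (ahead eq) → ≢₂ eq ; (behind eq) → ≢₃ eq }

  offset : ∀ {A B} → Aligned A B → ℤ
  offset (level _)  = 0ℤ
  offset (ahead _)  = 1ℤ
  offset (behind _) = -1ℤ

  ∣offset∣≤1 : ∀ {A B} (a : Aligned A B) → ∣ offset a ∣ ≤ 1
  ∣offset∣≤1 (level _)  = z≤n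
  ∣offset∣≤1 (ahead _)  = ℕ.≤-refl
  ∣offset∣≤1 (behind _) = ℕ.≤-refl

  offset-≅ : ∀ {A B} (a : Aligned A B) → + B ≅ + A + offset a
  offset-≅ {A} (level refl)  = ≅-reflexive (sym (ℤ.+-identityʳ (+ A)))
  offset-≅ {A} (ahead refl)  = ≅-trans (S-≅ A) (≅-reflexive (ℤ.+-comm 1ℤ (+ A)))
  offset-≅ {_} {B} (behind refl) = ≅-trans (≅-reflexive (lem (+ B))) (+-cong (≅-sym (S-≅ B)) (≅-refl { -1ℤ}))
    where
    lem : ∀ b → b ≡ 1ℤ + b + -1ℤ
    lem = solve-∀

  -- Heights X for which the cross edges at A and B carry no flow, given that all
  -- cross edges of the coordinate carry h on top of the difference of heights.
  record Quiet (h : ℤ) (A B : ℕ) (d : ℤ) : Set where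
    field
      X     : ℕ → ℤ
      at-A  : h + X (S A) - X A ≡ 0ℤ
      at-B  : h + X (S B) - X B ≡ 0ℤ
      climb : X A - X B ≡ d

  private
    -- Descends by `h` across the cross edges at `z` and `S z` and so cancels the circulation there;
    -- no pebble sees the jump back to 0. The three residues are distinct because `q` is at least 3.
    ramp : ℤ → ℕ → ℕ → ℤ
    ramp h z w with w ℕ.≟ z | w ℕ.≟ S z | w ℕ.≟ S (S z)
    ... | yes _ | _     | _     = 0ℤ
    ... | no _  | yes _ | _     = - h
    ... | no _  | no _  | yes _ = - h - h
    ... | no _  | no _  | no _  = 0ℤ

    ramp-0 : ∀ h z → ramp h z z ≡ 0ℤ
    ramp-0 h z with z ℕ.≟ z
    ... | yes _  = refl
    ... | no z≢z = ⊥-elim (z≢z refl)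

    ramp-1 : ∀ h z → ramp h z (S z) ≡ - h
    ramp-1 h z with S z ℕ.≟ z | S z ℕ.≟ S z
    ... | yes eq | _      = ⊥-elim (S≢ z eq)
    ... | no _   | yes _  = refl
    ... | no _   | no z≢z = ⊥-elim (z≢z refl)

    ramp-2 : ∀ h z → ramp h z (S (S z)) ≡ - h - h
    ramp-2 h z with S (S z) ℕ.≟ z | S (S z) ℕ.≟ S z | S (S z) ℕ.≟ S (S z)
    ... | yes eq | _      | _      = ⊥-elim (SS≢ z eq)
    ... | no _   | yes eq | _      = ⊥-elim (S≢ (S z) eq)
    ... | no _   | no _   | yes _  = refl
    ... | no _   | no _   | no z≢z = ⊥-elim (z≢z refl)

    lem₀ : ∀ h → h + - h - 0ℤ ≡ 0ℤ
    lem₀ = solve-∀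
    lem₁ : ∀ h → h + (- h - h) - - h ≡ 0ℤ
    lem₁ = solve-∀
    lem₂ : ∀ h → 0ℤ - - h ≡ 1ℤ * h
    lem₂ = solve-∀
    lem₃ : ∀ h → - h - 0ℤ ≡ -1ℤ * h
    lem₃ = solve-∀

    ramp-quiet₀ : ∀ h z → h + ramp h z (S z) - ramp h z z ≡ 0ℤ
    ramp-quiet₀ h z rewrite ramp-0 h z | ramp-1 h z = lem₀ h

    ramp-quiet₁ : ∀ h z → h + ramp h z (S (S z)) - ramp h z (S z) ≡ 0ℤ
    ramp-quiet₁ h z rewrite ramp-1 h z | ramp-2 h z = lem₁ h

  -- Quietness at `A` and `B` forces this climb, so a circulation is the only way to gain anything
  -- from aligned residues.
  aligned-quiet : ∀ h {A B} (a : Aligned A B) → Quiet h A B (offset a * h)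
  aligned-quiet h {A} (level refl) = record
    { X = ramp h A ; at-A = ramp-quiet₀ h A ; at-B = ramp-quiet₀ h A
    ; climb = trans (ℤ.+-inverseʳ (ramp h A A)) (sym (ℤ.*-zeroˡ h)) }
  aligned-quiet h {A} (ahead refl) = record
    { X = ramp h A ; at-A = ramp-quiet₀ h A ; at-B = ramp-quiet₁ h A
    ; climb = trans (cong₂ _-_ (ramp-0 h A) (ramp-1 h A)) (lem₂ h) }
  aligned-quiet h {B = B} (behind refl) = record
    { X = ramp h B ; at-A = ramp-quiet₁ h B ; at-B = ramp-quiet₀ h B
    ; climb = trans (cong₂ _-_ (ramp-1 h B) (ramp-0 h B)) (lem₃ h) }

  flat-quiet : ∀ A B → Quiet 0ℤ A B 0ℤ
  flat-quiet A B = record { X = λ _ → 0ℤ ; at-A = refl ; at-B = refl ; climb = refl }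

  -- Without alignment the faces around `A` and those around `B` are disjoint, so constant heights
  -- `θ` and 0 can be prescribed on them independently.
  apart-quiet : ∀ θ {A B} → A < q → B < q → ¬ Aligned A B → Quiet 0ℤ A B θ
  apart-quiet θ {A} {B} A<q B<q ¬al = record
    { X = X
    ; at-A = trans (cong₂ (λ x y → 0ℤ + x - y) (hit (S A) (inj₂ refl)) (hit A (inj₁ refl))) (lem θ)
    ; at-B = cong₂ (λ x y → 0ℤ + x - y) (miss (S B) (¬al ∘ behind ∘ sym) (¬al ∘ level ∘ S-injective B<q A<q))
                                       (miss B (¬al ∘ level) (¬al ∘ ahead))
    ; climb = trans (cong₂ _-_ (hit A (inj₁ refl)) (miss B (¬al ∘ level) (¬al ∘ ahead))) (ℤ.+-identityʳ θ)
    }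
    where
    lem : ∀ θ → 0ℤ + θ - θ ≡ 0ℤ
    lem = solve-∀
    X : ℕ → ℤ
    X w with w ℕ.≟ A | w ℕ.≟ S A
    ... | yes _ | _     = θ
    ... | no _  | yes _ = θ
    ... | no _  | no _  = 0ℤ
    hit : ∀ w → w ≡ A ⊎ w ≡ S A → X w ≡ θ
    hit w h with w ℕ.≟ A | w ℕ.≟ S A
    ... | yes _ | _     = refl
    ... | no _  | yes _ = refl
    hit w (inj₁ eq) | no ≢A | no _   = ⊥-elim (≢A eq)
    hit w (inj₂ eq) | no _  | no ≢SA = ⊥-elim (≢SA eq)
    miss : ∀ w → w ≢ A → w ≢ S A → X w ≡ 0ℤ
    miss w ≢A ≢SA with w ℕ.≟ A | w ℕ.≟ S A
    ... | yes eq | _      = ⊥-elim (≢A eq)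
    ... | no _   | yes eq = ⊥-elim (≢SA eq)
    ... | no _   | no _   = refl

-- The cylinder and its flows.

-- tor i c is the grid vertex in row i and column c, with ports for the flow entering and leaving
-- along the row and for the cross edges from row prev i and to row next i.  The edge variables
-- are named by residues of c, so c and c + p i · p (next i) are identified.  The row-i edge that
-- enters column 0 is also an edge of tail i, which passes its flow on to two hubs that absorb
-- none.  One hub would not do: a pebble on it would fix the flow of all the rows at once.
module Construction (k : ℕ) (2≤k : 2 ≤ k) (p : Fin k → ℕ) (3≤p : ∀ i → 3 ≤ p i) (C pads : ℕ) where

  instance
    k-nonZero : NonZero k
    k-nonZero = ℕ.>-nonZero (ℕ.<⇒≤ 2≤k)
    p-nonZero : ∀ {i} → NonZero (p i)
    p-nonZero {i} = ℕ.>-nonZero (ℕ.≤-trans (s≤s z≤n) (3≤p i))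

  open Cycle k

  S% : ∀ c i → suc (c ℕ.% p i) ℕ.% p i ≡ suc c ℕ.% p i
  S% c i = suc-% c (p i)

  Var : Set
  Var = (Fin k × ℕ × ℕ) ⊎ (Fin k × ℕ) ⊎ (Fin 2 × Fin k) ⊎ ⊤

  pattern flow i a b = inj₁ (i , a , b)
  pattern cross i a  = inj₂ (inj₁ (i , a))
  pattern drain g i  = inj₂ (inj₂ (inj₁ (g , i)))
  pattern idle       = inj₂ (inj₂ (inj₂ tt))

  _≟ᵛ_ : DecidableEquality Var
  _≟ᵛ_ = Sum.≡-dec (Product.≡-dec Fin._≟_ (Product.≡-dec ℕ._≟_ ℕ._≟_))
        (Sum.≡-dec (Product.≡-dec Fin._≟_ ℕ._≟_)
        (Sum.≡-dec (Product.≡-dec Fin._≟_ Fin._≟_) ⊤._≟_))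

  data Spot : Set where
    tor  : Fin k → Fin C → Spot
    tail : Fin k → Spot
    hub  : Fin 2 → Spot

  B D M : ℕ
  B = k ℕ.* C ℕ.+ (k ℕ.+ 2)
  D = 4 ℕ.+ k
  M = suc (k !)

  spot : Fin B → Spot
  spot x with splitAt (k ℕ.* C) x
  ... | inj₁ w = let i , c = remQuot C w in tor i c
  ... | inj₂ w with splitAt k w
  ...   | inj₁ i = tail i
  ...   | inj₂ g = hub g

  at : Spot → Fin B
  at (tor i c) = combine i c ↑ˡ (k ℕ.+ 2)
  at (tail i)  = (k ℕ.* C) ↑ʳ (i ↑ˡ 2)
  at (hub g)   = (k ℕ.* C) ↑ʳ (k ↑ʳ g)

  spot-at : ∀ s → spot (at s) ≡ s
  spot-at (tor i c) rewrite Fin.splitAt-↑ˡ (k ℕ.* C) (combine i c) (k ℕ.+ 2) =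
    cong (λ (i , c) → tor i c) (Fin.remQuot-combine i c)
  spot-at (tail i) rewrite Fin.splitAt-↑ʳ (k ℕ.* C) (k ℕ.+ 2) (i ↑ˡ 2) | Fin.splitAt-↑ˡ k i 2 = refl
  spot-at (hub g) rewrite Fin.splitAt-↑ʳ (k ℕ.* C) (k ℕ.+ 2) (k ↑ʳ g) | Fin.splitAt-↑ʳ k 2 g = refl

  pattern 0F = zero
  pattern 1F = suc zero
  pattern 2F = suc (suc zero)
  pattern 3F = suc (suc (suc zero))
  pattern 4F+ j = suc (suc (suc (suc j)))

  port : Spot → Fin D → Var
  port (tor i c) 0F = flow i (toℕ c ℕ.% p i) (toℕ c ℕ.% p (next i))
  port (tor i c) 1F = flow i (suc (toℕ c) ℕ.% p i) (suc (toℕ c) ℕ.% p (next i))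
  port (tor i c) 2F = cross i (toℕ c ℕ.% p i)
  port (tor i c) 3F = cross (next i) (toℕ c ℕ.% p (next i))
  port (tail i)  0F = flow i 0 0
  port (tail i)  1F = drain 0F i
  port (tail i)  2F = drain 1F i
  port (hub g)   (4F+ i) = drain g i
  port _         _ = idle

  sign : Spot → Fin D → ℤ
  sign (tor i c) 0F = 1ℤ
  sign (tor i c) 1F = -1ℤ
  sign (tor i c) 2F = 1ℤ
  sign (tor i c) 3F = -1ℤ
  sign (tail i)  0F = 1ℤ
  sign (tail i)  1F = -1ℤ
  sign (tail i)  2F = -1ℤ
  sign (hub g)   (4F+ i) = 1ℤ
  sign _         _ = 0ℤ

  var : Fin B → Fin D → Var
  var x = port (spot x)

  coef : Fin B → Fin D → ℤ
  coef x = sign (spot x)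

  open LinearGraph B D M pads Var _≟ᵛ_ var coef public

  -- The solutions used by Duplicator: height differences plus a constant circulation (twist)
  -- around the cylinder plus a constant flow (base) along each row; drained is the part of the
  -- flow of tail i that goes to the first hub.  They satisfy all equations but those of the hubs.
  record Flow : Set where
    field
      twist    : ℤ
      height   : Fin k → ℕ → ℤ
      base     : Fin k → ℤ
      drained  : Fin k → ℤ
  open Flow

  -- `height σ i` is a potential on the faces between rows `prev i` and `i`, indexed modulo `p i`.
  -- An edge carries the difference of the potentials of the two faces it separates, which makes
  -- conservation at grid vertices automatic. The second hub receives what the first leaves over.
  ⟦_⟧ : Flow → Var → ℤ
  ⟦ σ ⟧ (flow i a b)  = base σ i + height σ i a - height σ (next i) b
  ⟦ σ ⟧ (cross i a)   = twist σ + height σ i (suc a ℕ.% p i) - height σ i a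
  ⟦ σ ⟧ (drain 0F i)  = drained σ i
  ⟦ σ ⟧ (drain 1F i)  = base σ i + height σ i 0 - height σ (next i) 0 - drained σ i
  ⟦ σ ⟧ idle          = 0ℤ

  record Full (σ : Flow) : Set where
    field
      base≡0    : ∑ (base σ) ≡ 0ℤ
      drained≡0 : ∑ (drained σ) ≡ 0ℤ

  IsHub : Place → Set
  IsHub nothing  = ⊥
  IsHub (just x) = ∃[ g ] spot x ≡ hub g

  satisfied : ∀ σ s → (∀ g → s ≢ hub g) → ∑ (λ q → sign s q * ⟦ σ ⟧ (port s q)) ≡ 0ℤ
  satisfied σ (tor i c) _ = trans
    (cong₂ (λ u w → 1ℤ * ⟦ σ ⟧ (port s 0F) + (-1ℤ * ⟦ σ ⟧ (port s 1F) + (1ℤ * (twist σ + u - height σ i (toℕ c ℕ.% p i)) +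
                     (-1ℤ * (twist σ + w - height σ (next i) (toℕ c ℕ.% p (next i))) + ∑ {k} (λ _ → 0ℤ * 0ℤ)))))
      (cong (height σ i) (S% (toℕ c) i)) (cong (height σ (next i)) (S% (toℕ c) (next i))))
    (lem (base σ i) (twist σ) (height σ i (toℕ c ℕ.% p i)) (height σ i (suc (toℕ c) ℕ.% p i))
         (height σ (next i) (toℕ c ℕ.% p (next i))) (height σ (next i) (suc (toℕ c) ℕ.% p (next i)))
         (∑-zero {k} λ _ → refl))
    where
    s = tor i c
    lem₀ : ∀ b h x x′ y y′ →
      1ℤ * (b + x - y) + (-1ℤ * (b + x′ - y′) + (1ℤ * (h + x′ - x) + (-1ℤ * (h + y′ - y) + 0ℤ))) ≡ 0ℤ
    lem₀ = solve-∀
    lem : ∀ b h x x′ y y′ {z} → z ≡ 0ℤ →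
      1ℤ * (b + x - y) + (-1ℤ * (b + x′ - y′) + (1ℤ * (h + x′ - x) + (-1ℤ * (h + y′ - y) + z))) ≡ 0ℤ
    lem b h x x′ y y′ refl = lem₀ b h x x′ y y′
  satisfied σ (tail i) _ =
    lem (base σ i) (height σ i 0) (height σ (next i) 0) (drained σ i) (∑-zero {k} λ _ → refl)
    where
    lem₀ : ∀ b x y d →
      1ℤ * (b + x - y) + (-1ℤ * d + (-1ℤ * (b + x - y - d) + (0ℤ * 0ℤ + 0ℤ))) ≡ 0ℤ
    lem₀ = solve-∀
    lem : ∀ b x y d {z} → z ≡ 0ℤ →
      1ℤ * (b + x - y) + (-1ℤ * d + (-1ℤ * (b + x - y - d) + (0ℤ * 0ℤ + z))) ≡ 0ℤ
    lem b x y d refl = lem₀ b x y d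
  satisfied σ (hub g) ¬hub = ⊥-elim (¬hub g refl)

  satisfied-hub : ∀ σ → Full σ → ∀ g → ∑ (λ q → sign (hub g) q * ⟦ σ ⟧ (port (hub g) q)) ≡ 0ℤ
  satisfied-hub σ full g = trans (lem (∑ (λ i → 1ℤ * ⟦ σ ⟧ (drain g i))))
    (trans (∑-cong (λ i → ℤ.*-identityˡ (⟦ σ ⟧ (drain g i)))) (go g))
    where
    lem : ∀ z → 0ℤ * 0ℤ + (0ℤ * 0ℤ + (0ℤ * 0ℤ + (0ℤ * 0ℤ + z))) ≡ z
    lem = solve-∀
    lem′ : ∀ a → 0ℤ + a - a - 0ℤ ≡ 0ℤ
    lem′ = solve-∀
    go : ∀ g → ∑ (λ i → ⟦ σ ⟧ (drain g i)) ≡ 0ℤ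
    go 0F = Full.drained≡0 full
    go 1F = begin
      ∑ (λ i → base σ i + height σ i 0 - height σ (next i) 0 - drained σ i)
        ≡⟨ ∑-difference (λ i → base σ i + height σ i 0 - height σ (next i) 0) (drained σ) ⟩
      ∑ (λ i → base σ i + height σ i 0 - height σ (next i) 0) - ∑ (drained σ)
        ≡⟨ cong (_- ∑ (drained σ)) (∑-difference (λ i → base σ i + height σ i 0) (λ i → height σ (next i) 0)) ⟩
      ∑ (λ i → base σ i + height σ i 0) - ∑ (λ i → height σ (next i) 0) - ∑ (drained σ)
        ≡⟨ cong₂ (λ x y → x - y - ∑ (drained σ)) (∑-+ (base σ) (λ i → height σ i 0)) (∑-next (λ i → height σ i 0)) ⟩
      ∑ (base σ) + ∑ (λ i → height σ i 0) - ∑ (λ i → height σ i 0) - ∑ (drained σ)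
        ≡⟨ cong₂ (λ x y → x + ∑ (λ i → height σ i 0) - ∑ (λ i → height σ i 0) - y) (Full.base≡0 full) (Full.drained≡0 full) ⟩
      0ℤ + ∑ (λ i → height σ i 0) - ∑ (λ i → height σ i 0) - 0ℤ
        ≡⟨ lem′ (∑ (λ i → height σ i 0)) ⟩
      0ℤ ∎
      where open ≡-Reasoning

  full⇒satisfies : ∀ σ → Full σ → ∀ y → Satisfies ⟦ σ ⟧ y
  full⇒satisfies σ full nothing = tt
  full⇒satisfies σ full (just x) with spot x
  ... | tor i c = satisfied σ (tor i c) λ _ ()
  ... | tail i  = satisfied σ (tail i) λ _ ()
  ... | hub g   = satisfied-hub σ full g

  ¬hub⇒satisfies : ∀ σ y → ¬ IsHub y → Satisfies ⟦ σ ⟧ y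
  ¬hub⇒satisfies σ nothing  _    = tt
  ¬hub⇒satisfies σ (just x) ¬hub = satisfied σ (spot x) (λ g eq → ¬hub (g , eq))

  agree-refl : ∀ s y → Agree s s y
  agree-refl s nothing  = tt
  agree-refl s (just x) = λ _ → refl

  full-wins : ∀ r σ → Full σ → ∀ P → Wins {k} r P ⟦ σ ⟧
  full-wins zero    σ full P = λ i → full⇒satisfies σ full (P i)
  full-wins (suc r) σ full P = full-wins r σ full P , λ y → ⟦ σ ⟧ , λ i → ⟦ σ ⟧ ,
    agree-refl ⟦ σ ⟧ y , (λ j _ → agree-refl ⟦ σ ⟧ (P j)) , λ P′ _ _ → full-wins r σ full P′

  infixl 6 _⊕_
  _⊕_ : Flow → Flow → Flow
  σ ⊕ δ = record
    { twist   = twist σ + twist δ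
    ; height  = λ i a → height σ i a + height δ i a
    ; base    = λ i → base σ i + base δ i
    ; drained = λ i → drained σ i + drained δ i
    }

  ⟦⊕⟧ : ∀ σ δ v → ⟦ σ ⊕ δ ⟧ v ≡ ⟦ σ ⟧ v + ⟦ δ ⟧ v
  ⟦⊕⟧ σ δ (flow i a b) = lem (base σ i) (base δ i) (height σ i a) (height δ i a) (height σ (next i) b) (height δ (next i) b)
    where
    lem : ∀ b b′ x x′ y y′ → b + b′ + (x + x′) - (y + y′) ≡ b + x - y + (b′ + x′ - y′)
    lem = solve-∀
  ⟦⊕⟧ σ δ (cross i a) = lem (twist σ) (twist δ) (height σ i a⁺) (height δ i a⁺) (height σ i a) (height δ i a)
    where
    a⁺ = suc a ℕ.% p i
    lem : ∀ b b′ x x′ y y′ → b + b′ + (x + x′) - (y + y′) ≡ b + x - y + (b′ + x′ - y′)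
    lem = solve-∀
  ⟦⊕⟧ σ δ (drain 0F i) = refl
  ⟦⊕⟧ σ δ (drain 1F i) = lem (base σ i) (base δ i) (height σ i 0) (height δ i 0) (height σ (next i) 0) (height δ (next i) 0)
      (drained σ i) (drained δ i)
    where
    lem : ∀ b b′ x x′ y y′ d d′ → b + b′ + (x + x′) - (y + y′) - (d + d′) ≡ b + x - y - d + (b′ + x′ - y′ - d′)
    lem = solve-∀
  ⟦⊕⟧ σ δ idle = refl

  Silent : Flow → Place → Set
  Silent δ nothing  = ⊤
  Silent δ (just x) = ∀ q → ⟦ δ ⟧ (var x q) ≡ 0ℤ

  silent⇒agree : ∀ σ δ y → Silent δ y → Agree ⟦ σ ⟧ ⟦ σ ⊕ δ ⟧ y
  silent⇒agree σ δ nothing  _   = tt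
  silent⇒agree σ δ (just x) sil q = sym (trans (⟦⊕⟧ σ δ (var x q))
    (trans (cong (_+_ (⟦ σ ⟧ (var x q))) (sil q)) (ℤ.+-identityʳ _)))

  -- A tail counts as column 0 of its row, whose incoming edge it shares; thus one condition
  -- `NullAt` silences a flow on grid vertices and tails alike.
  locate : Spot → Maybe (Fin k × ℕ)
  locate (tor i c) = just (i , toℕ c)
  locate (tail i)  = just (i , 0)
  locate (hub g)   = nothing

  locatePlace : Place → Maybe (Fin k × ℕ)
  locatePlace nothing  = nothing
  locatePlace (just x) = locate (spot x)

  record NullAt (δ : Flow) (i : Fin k) (c : ℕ) : Set where
    field
      flow≡0    : ⟦ δ ⟧ (flow i (c ℕ.% p i) (c ℕ.% p (next i))) ≡ 0ℤ
      cross≡0   : ⟦ δ ⟧ (cross i (c ℕ.% p i)) ≡ 0ℤ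
      cross′≡0  : ⟦ δ ⟧ (cross (next i) (c ℕ.% p (next i))) ≡ 0ℤ
      drained≡0 : drained δ i ≡ 0ℤ

  null⇒silent : ∀ {δ i c} → NullAt δ i c → ∀ y → locatePlace y ≡ just (i , c) → Silent δ y
  null⇒silent {δ} null (just x) loc = go (spot x) loc null
    where
    go : ∀ s {i c} → locate s ≡ just (i , c) → NullAt δ i c → ∀ q → ⟦ δ ⟧ (port s q) ≡ 0ℤ
    go (tor i c) refl null 0F = NullAt.flow≡0 null
    -- By conservation, three silent edges of a grid vertex silence the fourth.
    go (tor i c) refl null 1F = begin
      base δ i + height δ i (suc c′ ℕ.% p i) - height δ (next i) (suc c′ ℕ.% p (next i))
        ≡⟨ cong₂ (λ u w → base δ i + height δ i u - height δ (next i) w) (S% c′ i) (S% c′ (next i)) ⟨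
      base δ i + height δ i (suc (c′ ℕ.% p i) ℕ.% p i) - height δ (next i) (suc (c′ ℕ.% p (next i)) ℕ.% p (next i))
        ≡⟨ lem (base δ i) (twist δ) (height δ i (c′ ℕ.% p i)) _ (height δ (next i) (c′ ℕ.% p (next i))) _ ⟩
      ⟦ δ ⟧ (flow i (c′ ℕ.% p i) (c′ ℕ.% p (next i))) + ⟦ δ ⟧ (cross i (c′ ℕ.% p i)) - ⟦ δ ⟧ (cross (next i) (c′ ℕ.% p (next i)))
        ≡⟨ cong₂ _-_ (cong₂ _+_ (NullAt.flow≡0 null) (NullAt.cross≡0 null)) (NullAt.cross′≡0 null) ⟩
      0ℤ ∎
      where
      open ≡-Reasoning
      c′ = toℕ c
      lem : ∀ b h x x′ y y′ → b + x′ - y′ ≡ b + x - y + (h + x′ - x) - (h + y′ - y)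
      lem = solve-∀
    go (tor i c) refl null 2F = NullAt.cross≡0 null
    go (tor i c) refl null 3F = NullAt.cross′≡0 null
    go (tor i c) refl null (4F+ _) = refl
    go (tail i) refl null = λ where
        0F → flow≡0
        1F → NullAt.drained≡0 null
        2F → cong₂ _-_ flow≡0 (NullAt.drained≡0 null)
        3F → refl
        (4F+ _) → refl
      where
      flow≡0 : ⟦ δ ⟧ (flow i 0 0) ≡ 0ℤ
      flow≡0 = subst₂ (λ a b → ⟦ δ ⟧ (flow i a b) ≡ 0ℤ) (ℕ.m<n⇒m%n≡m (ℕ.>-nonZero⁻¹ (p i)))
        (ℕ.m<n⇒m%n≡m (ℕ.>-nonZero⁻¹ (p (next i)))) (NullAt.flow≡0 null)

  -- Divisible by every possible winding number of a column, and nonzero modulo M.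
  φ : ℤ
  φ = + (k !)

  -- Cancels the whole excess in a single row, which goes unnoticed once no pebble sees that row.
  removal : Fin k → Flow
  removal l = record { twist = 0ℤ ; height = λ _ _ → 0ℤ ; base = λ i → [ i ≡? l ] * - φ ; drained = λ _ → 0ℤ }

  removal-null : ∀ {l i} c → i ≢ l → NullAt (removal l) i c
  removal-null c i≢l = record
    { flow≡0 = cong (λ z → z * - φ + 0ℤ - 0ℤ) ([≢] i≢l) ; cross≡0 = refl ; cross′≡0 = refl ; drained≡0 = refl }

  ∑-removal : ∀ l → ∑ (base (removal l)) ≡ - φ
  ∑-removal l = ∑-[] l (- φ)

  module _ (c : Fin k → ℕ) where

    private
      A B′ : Fin k → ℕ
      A l  = c (prev l) ℕ.% p l
      B′ l = c l ℕ.% p l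

      module Coord l = Profile (p l) (3≤p l)

    -- Heights of different coordinates can be chosen independently. Silence of the row edge at
    -- `c i` then determines `base`, and its sum regroups around the cylinder into the sum of the
    -- climbs.
    quietFlow : ∀ h {d : Fin k → ℤ} → (∀ l → Coord.Quiet l h (A l) (B′ l) (d l)) →
      ∃[ δ ] (∑ (base δ) ≡ ∑ d × (∀ i → NullAt δ i (c i)))
    quietFlow h {d} quiet = δ , ∑base , null
      where
      X : Fin k → ℕ → ℤ
      X l = Coord.Quiet.X (quiet l)
      δ : Flow
      δ = record
        { twist = h ; height = X ; drained = λ _ → 0ℤ
        ; base = λ i → X (next i) (c i ℕ.% p (next i)) - X i (c i ℕ.% p i) }
      ∑base : ∑ (base δ) ≡ ∑ d
      ∑base = begin
        ∑ (base δ)                                   ≡⟨ ∑-difference (λ i → X (next i) (c i ℕ.% p (next i))) (λ i → X i (B′ i)) ⟩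
        ∑ (λ i → X (next i) (c i ℕ.% p (next i))) - ∑ (λ i → X i (B′ i))
          ≡⟨ cong (_- ∑ (λ i → X i (B′ i))) (∑-cong λ i → cong (λ j → X (next i) (c j ℕ.% p (next i))) (sym (prev-next i))) ⟩
        ∑ ((λ l → X l (A l)) ∘ next) - ∑ (λ i → X i (B′ i))
          ≡⟨ cong (_- ∑ (λ i → X i (B′ i))) (∑-next (λ l → X l (A l))) ⟩
        ∑ (λ l → X l (A l)) - ∑ (λ i → X i (B′ i))   ≡⟨ ∑-difference (λ l → X l (A l)) (λ l → X l (B′ l)) ⟨
        ∑ (λ l → X l (A l) - X l (B′ l))             ≡⟨ ∑-cong (λ l → Coord.Quiet.climb (quiet l)) ⟩
        ∑ d ∎
        where open ≡-Reasoning
      lem : ∀ x y → y - x + x - y ≡ 0ℤ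
      lem = solve-∀
      null : ∀ i → NullAt δ i (c i)
      null i = record
        { flow≡0    = lem (X i (c i ℕ.% p i)) (X (next i) (c i ℕ.% p (next i)))
        ; cross≡0   = Coord.Quiet.at-B (quiet i)
        ; cross′≡0  = subst (λ j → h + X (next i) (suc (c j ℕ.% p (next i)) ℕ.% p (next i)) - X (next i) (c j ℕ.% p (next i)) ≡ 0ℤ)
                        (prev-next i) (Coord.Quiet.at-A (quiet (next i)))
        ; drained≡0 = refl }

    Winding : (Fin k → ℤ) → Set
    Winding d = (∀ l → ∣ d l ∣ ≤ 1) × (∀ l → Congruence._≅_ (p l) (+ c l) (+ c (prev l) + d l)) × ∑ d ≡ 0ℤ

    -- A full column of pebbles lets the flow be changed unless the columns of
    -- neighbouring rows differ by at most one step and these steps add up to zero.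
    reroute : (∃[ δ ] (∑ (base δ) ≡ - φ × (∀ i → NullAt δ i (c i)))) ⊎ ∃[ d ] Winding d
    reroute with Fin.all? (λ l → Coord.aligned? l (A l) (B′ l))
    -- A single gap absorbs all of `- φ`; the other coordinates stay flat.
    ... | no ¬all = inj₁ (let l , ¬al = Fin.¬∀⟶∃¬ k _ (λ l → Coord.aligned? l (A l) (B′ l)) ¬all
                              δ , ∑≡ , null = quietFlow 0ℤ (quiet l ¬al)
                          in δ , trans ∑≡ (∑-[] l (- φ)) , null)
      where
      quiet : ∀ l → ¬ Coord.Aligned l (A l) (B′ l) → ∀ i → Coord.Quiet i 0ℤ (A i) (B′ i) ([ i ≡? l ] * - φ)
      quiet l ¬al i with i Fin.≟ l
      ... | yes refl = subst (Coord.Quiet i 0ℤ (A i) (B′ i)) (sym (ℤ.*-identityˡ (- φ)))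
                         (Coord.apart-quiet i (- φ) (ℕ.m%n<n _ (p i)) (ℕ.m%n<n _ (p i)) ¬al)
      ... | no _     = Coord.flat-quiet i (A i) (B′ i)
    ... | yes al with ∑ (λ l → Coord.offset l (al l)) ℤ.≟ 0ℤ
    ...   | yes ∑≡0 = inj₂ ((λ l → Coord.offset l (al l)) , (λ l → Coord.∣offset∣≤1 l (al l)) , steps , ∑≡0)
      where
      steps : ∀ l → Congruence._≅_ (p l) (+ c l) (+ c (prev l) + Coord.offset l (al l))
      steps l = ≅-trans (≅-sym (%-≅ (c l))) (≅-trans (Coord.offset-≅ l (al l)) (+-cong (%-≅ (c (prev l))) (≅-refl {Coord.offset l (al l)})))
        where open Congruence (p l)
    -- A helix: the circulation `h` solves winding number times `h` equals `- φ`, which is possible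
    -- because the winding number is at most `k` in absolute value and so divides `k !`.
    ...   | no ∑≢0 = inj₁ (δ , trans ∑≡ (trans (∑-*ʳ offs h) σh≡) , null)
      where
      offs : Fin k → ℤ
      offs l = Coord.offset l (al l)
      factor = factor-of-! k (∑ offs) ∑≢0 (∑-bounded offs (λ l → Coord.∣offset∣≤1 l (al l)))
      h = proj₁ factor
      σh≡ = proj₂ factor
      quieted = quietFlow h (λ l → Coord.aligned-quiet l h (al l))
      δ = proj₁ quieted
      ∑≡ = proj₁ (proj₂ quieted)
      null = proj₂ (proj₂ quieted)

  ∣∣≤1⇒bounds : ∀ {d} → ∣ d ∣ ≤ 1 → -1ℤ ℤ.≤ d × d ℤ.≤ 1ℤ
  ∣∣≤1⇒bounds {+ 0}     _ = ℤ.-≤+ , ℤ.+≤+ z≤n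
  ∣∣≤1⇒bounds {+ 1}     _ = ℤ.-≤+ , ℤ.+≤+ ℕ.≤-refl
  ∣∣≤1⇒bounds {+ suc (suc n)} (s≤s ())
  ∣∣≤1⇒bounds { -[1+ 0 ]} _ = ℤ.≤-refl , ℤ.-≤+
  ∣∣≤1⇒bounds { -[1+ suc n ]} (s≤s ())

  -- Duplicator's strategy.

  -- L bounds the time for which lifting columns to integers is unambiguous.
  module Duplicator (L : ℕ) (apart : ∀ m → (∀ j → p j ℕ.∣ ∣ m ∣) → 1ℤ ℤ.≤ m → m + 1ℤ ℤ.≤ + L → ⊥) where

    -- The pebbles form a column that is at least r moves away from column 0 in either direction,
    -- and only the second hub is violated.
    record Tracked (r : ℕ) (P : Fin k → Place) (σ : Flow) : Set where
      field
        total     : ∑ (base σ) ≡ φ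
        drained≡0 : ∑ (drained σ) ≡ 0ℤ
        c         : Fin k → ℕ
        m         : Fin k → ℤ
        on        : ∀ j → locatePlace (P j) ≡ just (j , c j)
        lift      : ∀ j → Congruence._≅_ (p j) (+ c j) (m j)
        lift′     : ∀ j → Congruence._≅_ (p (next j)) (+ c j) (m j)
        near      : ∀ l → ∣ m l - m (prev l) ∣ ≤ 1
        low       : ∀ j → + suc r ℤ.≤ m j
        high      : ∀ j → m j + + suc r ℤ.≤ + L

    lift-prev : ∀ {r P σ} (T : Tracked r P σ) l →
                Congruence._≅_ (p l) (+ Tracked.c T (prev l)) (Tracked.m T (prev l))
    lift-prev T l = subst (λ j → Congruence._≅_ (p j) (+ Tracked.c T (prev l)) (Tracked.m T (prev l)))
      (next-prev l) (Tracked.lift′ T (prev l))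

    weaken : ∀ {r P σ} → Tracked (suc r) P σ → Tracked r P σ
    weaken {r} T = record
      { total = total ; drained≡0 = drained≡0 ; c = c ; m = m ; on = on ; lift = lift ; lift′ = lift′ ; near = near
      ; low  = λ j → ℤ.≤-trans (ℤ.+≤+ (ℕ.n≤1+n (suc r))) (low j)
      ; high = λ j → ℤ.≤-trans (ℤ.+-monoʳ-≤ (m j) (ℤ.+≤+ (ℕ.n≤1+n (suc r)))) (high j) }
      where open Tracked T

    module Track {r P σ} (T : Tracked (suc r) P σ) (j₀ : Fin k) {P′ : Fin k → Place} {c′ : Fin k → ℕ} {d : Fin k → ℤ}
                 (on′ : ∀ j → locatePlace (P′ j) ≡ just (j , c′ j)) (c′≡c : ∀ j → j ≢ j₀ → c′ j ≡ Tracked.c T j)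
                 (winding : Winding c′ d) where
      open Tracked T

      d≤1 : ∀ l → ∣ d l ∣ ≤ 1
      d≤1 = proj₁ winding

      m′ : Fin k → ℤ
      m′ j with j Fin.≟ j₀
      ... | yes _ = m (prev j₀) + d j₀
      ... | no _  = m j

      m′-new : m′ j₀ ≡ m (prev j₀) + d j₀
      m′-new with j₀ Fin.≟ j₀
      ... | yes _ = refl
      ... | no ≢  = ⊥-elim (≢ refl)

      m′-old : ∀ {j} → j ≢ j₀ → m′ j ≡ m j
      m′-old {j} j≢ with j Fin.≟ j₀
      ... | yes eq = ⊥-elim (j≢ eq)
      ... | no _   = refl

      private
        error : Fin k → ℤ
        error l = m′ l - (m′ (prev l) + d l)

        error-new : error j₀ ≡ 0ℤ
        error-new = trans (cong₂ (λ x y → x - (y + d j₀)) m′-new (m′-old (prev≢ 2≤k j₀))) (ℤ.+-inverseʳ (m (prev j₀) + d j₀))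

        -- Neither pebble of this link has moved. The old and the new step have absolute value at
        -- most 1 and are congruent modulo `p l`, which is at least 3, so they agree.
        error-old : ∀ {l} → l ≢ j₀ → prev l ≢ j₀ → error l ≡ 0ℤ
        error-old {l} l≢ prevl≢ = trans
          (cong₂ (λ x y → x - (y + d l)) (m′-old l≢) (m′-old prevl≢))
          (ℤ.i≡j⇒i-j≡0 (≅-small
            (≅-trans (≅-sym (lift l)) (≅-trans (≅-reflexive (cong +_ (sym (c′≡c l l≢))))
              (≅-trans (proj₁ (proj₂ winding) l)
                (+-cong (≅-trans (≅-reflexive (cong +_ (c′≡c (prev l) prevl≢))) (lift-prev T l)) (≅-refl {d l})))))
            (ℕ.<-≤-trans (s≤s small) (3≤p l))))
          where
          open Congruence (p l)
          lem : ∀ a b d → a - (b + d) ≡ a - b + - d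
          lem = solve-∀
          small : ∣ m l - (m (prev l) + d l) ∣ ≤ 2
          small = subst (λ z → ∣ z ∣ ≤ 2) (sym (lem (m l) (m (prev l)) (d l)))
            (ℕ.≤-trans (ℤ.∣i+j∣≤∣i∣+∣j∣ (m l - m (prev l)) (- d l))
              (ℕ.+-mono-≤ (near l) (subst (_≤ 1) (sym (ℤ.∣-i∣≡∣i∣ (d l))) (d≤1 l))))

        ∑-error : ∑ error ≡ 0ℤ
        ∑-error = begin
          ∑ error                                   ≡⟨ ∑-difference m′ (λ l → m′ (prev l) + d l) ⟩
          ∑ m′ - ∑ (λ l → m′ (prev l) + d l)         ≡⟨ cong (_-_ (∑ m′)) (∑-+ (m′ ∘ prev) d) ⟩
          ∑ m′ - (∑ (m′ ∘ prev) + ∑ d)               ≡⟨ cong₂ (λ x y → ∑ m′ - (x + y)) ∑-prev (proj₂ (proj₂ winding)) ⟩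
          ∑ m′ - (∑ m′ + 0ℤ)                         ≡⟨ cong (_-_ (∑ m′)) (ℤ.+-identityʳ (∑ m′)) ⟩
          ∑ m′ - ∑ m′                                ≡⟨ ℤ.+-inverseʳ (∑ m′) ⟩
          0ℤ ∎
          where
          open ≡-Reasoning
          ∑-prev : ∑ (m′ ∘ prev) ≡ ∑ m′
          ∑-prev = trans (sym (∑-next (m′ ∘ prev))) (∑-cong (λ i → cong m′ (prev-next i)))

        -- The link from `j₀` to its successor is the only one not checked directly. The errors sum
        -- to minus the winding number, which is 0, so this last error vanishes with the others.
        error≡0 : ∀ l → error l ≡ 0ℤ
        error≡0 l = go (l Fin.≟ j₀) (prev l Fin.≟ j₀)
          where
          others : prev l ≡ j₀ → ∀ i → i ≢ l → error i ≡ 0ℤ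
          others refl i i≢l = others′ (i Fin.≟ prev l)
            where
            others′ : Dec (i ≡ prev l) → error i ≡ 0ℤ
            others′ (yes refl) = error-new
            others′ (no i≢)    = error-old i≢ λ eq → i≢l (trans (sym (next-prev i)) (trans (cong next eq) (next-prev l)))
          go : Dec (l ≡ j₀) → Dec (prev l ≡ j₀) → error l ≡ 0ℤ
          go (yes refl) _        = error-new
          go (no l≢)    (no p≢)  = error-old l≢ p≢
          go (no l≢)    (yes eq) = trans (sym (∑-single error l (others eq))) ∑-error

        step : ∀ l → m′ l ≡ m′ (prev l) + d l
        step l = ℤ.i-j≡0⇒i≡j (m′ l) (m′ (prev l) + d l) (error≡0 l)

      tracked : Tracked r P′ σ
      tracked = record
        { total = total ; drained≡0 = drained≡0 ; c = c′ ; m = m′ ; on = on′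
        ; lift = lifted ; lift′ = lifted′
        ; near = λ l → subst (λ z → ∣ z ∣ ≤ 1) (sym (trans (cong (_- m′ (prev l)) (step l)) (lem (m′ (prev l)) (d l)))) (d≤1 l)
        ; low = lower ; high = upper }
        where
        lem : ∀ a b → a + b - a ≡ b
        lem = solve-∀
        lifted : ∀ j → Congruence._≅_ (p j) (+ c′ j) (m′ j)
        lifted j with j Fin.≟ j₀
        ... | no j≢ = subst (λ x → Congruence._≅_ (p j) (+ x) (m j)) (sym (c′≡c j j≢)) (lift j)
        ... | yes refl = ≅-trans (proj₁ (proj₂ winding) j)
                (+-cong (≅-trans (≅-reflexive (cong +_ (c′≡c (prev j) (prev≢ 2≤k j)))) (lift-prev T j)) (≅-refl {d j}))
          where open Congruence (p j)
        lifted′ : ∀ j → Congruence._≅_ (p (next j)) (+ c′ j) (m′ j)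
        lifted′ j with j Fin.≟ j₀ in eq
        ... | no j≢ = subst (λ x → Congruence._≅_ (p (next j)) (+ x) (m j)) (sym (c′≡c j j≢)) (lift′ j)
        -- The second residue of the new pebble is recovered backwards from the pebble of the next
        -- row, using that the lift closes up.
        ... | yes refl = subst (λ z → + c′ j ≅ z) m′-new (+-cancelʳ (d (next j))
                (≅-trans (≅-sym (subst (λ i → + c′ (next j) ≅ + c′ i + d (next j)) (prev-next j) (proj₁ (proj₂ winding) (next j))))
                (≅-trans (lifted (next j)) (≅-reflexive (trans (step (next j)) (cong (λ i → m′ i + d (next j)) (prev-next j)))))))
          where open Congruence (p (next j))
        -- The new lift is within 1 of the lift in the previous row, whose margin was one larger.
        lower : ∀ j → + suc r ℤ.≤ m′ j
        lower j with j Fin.≟ j₀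
        ... | no _     = Tracked.low (weaken T) j
        ... | yes refl = ℤ.≤-trans (ℤ.≤-reflexive (sym (ℤ.[1+m]⊖[1+n]≡m⊖n (suc r) 0)))
                (ℤ.+-mono-≤ (low (prev j)) (proj₁ (∣∣≤1⇒bounds (d≤1 j))))
        upper : ∀ j → m′ j + + suc r ℤ.≤ + L
        upper j with j Fin.≟ j₀
        ... | no _     = Tracked.high (weaken T) j
        ... | yes refl = ℤ.≤-trans (ℤ.+-monoˡ-≤ (+ suc r) (ℤ.+-monoʳ-≤ (m (prev j)) (proj₂ (∣∣≤1⇒bounds (d≤1 j)))))
                (ℤ.≤-trans (ℤ.≤-reflexive (ℤ.+-assoc (m (prev j)) 1ℤ (+ suc r))) (high (prev j)))

    full-⊕ : ∀ {r P σ} → Tracked r P σ → ∀ δ → ∑ (base δ) ≡ - φ → ∑ (drained δ) ≡ 0ℤ → Full (σ ⊕ δ)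
    full-⊕ {σ = σ} T δ base≡ drained≡ = record
      { base≡0    = trans (∑-+ (base σ) (base δ)) (trans (cong₂ _+_ (Tracked.total T) base≡) (ℤ.+-inverseʳ φ))
      ; drained≡0 = trans (∑-+ (drained σ) (drained δ)) (cong₂ _+_ (Tracked.drained≡0 T) drained≡) }

    removal-silent : ∀ l y → ¬ IsHub y → (∀ d → locatePlace y ≢ just (l , d)) → Silent (removal l) y
    removal-silent l nothing  _ _ = tt
    removal-silent l (just x) ¬hub ¬row with locate (spot x) in eq
    ... | just (i , d) = null⇒silent (removal-null d λ { refl → ¬row d refl }) (just x) eq
    ... | nothing with spot x in eq′
    ...   | hub g  = ⊥-elim (¬hub (g , refl))

    -- If all columns were 0, the lifts would all be equal, hence divisible by every period.
    nonzero-column : ∀ {r P σ} (T : Tracked r P σ) → ∃[ a ] Tracked.c T a ≢ 0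
    nonzero-column {r} T with Fin.all? (λ j → Tracked.c T j ℕ.≟ 0)
    ... | no ¬all = Fin.¬∀⟶∃¬ k _ (λ j → Tracked.c T j ℕ.≟ 0) ¬all
    ... | yes all = ⊥-elim (apart (m j₀) (λ j → Congruence.≅⇒∣ (p j) (subst (λ z → Congruence._≅_ (p j) z 0ℤ) (constant m same j j₀) (m≅0 j)))
                      (ℤ.≤-trans (ℤ.+≤+ (s≤s z≤n)) (low j₀))
                      (ℤ.≤-trans (ℤ.+-monoʳ-≤ (m j₀) (ℤ.+≤+ (s≤s z≤n))) (high j₀)))
      where
      open Tracked T
      j₀ : Fin k
      j₀ = fromℕ< (ℕ.>-nonZero⁻¹ k)
      m≅0 : ∀ l → Congruence._≅_ (p l) (m l) 0ℤ
      m≅0 l = ≅-trans (≅-sym (lift l)) (≅-reflexive (cong +_ (all l)))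
        where open Congruence (p l)
      same : ∀ i → m (next i) ≡ m i
      same i = subst (λ j → m (next i) ≡ m j) (prev-next i) (≅-small
        (≅-trans (m≅0 (next i)) (≅-trans (≅-reflexive (cong +_ (sym (all (prev (next i)))))) (lift-prev T (next i))))
        (ℕ.≤-<-trans (near (next i)) (ℕ.<-≤-trans (s≤s (s≤s z≤n)) (3≤p (next i)))))
        where open Congruence (p (next i))

    data Kind (y : Place) : Set where
      plain : ¬ IsHub y → Kind y
      hubᵏ  : ∀ x g → y ≡ just x → spot x ≡ hub g → Kind y

    kind : ∀ y → Kind y
    kind nothing = plain λ ()
    kind (just x) with spot x in eq
    ... | hub g   = hubᵏ x g refl eq
    ... | tor _ _ = plain λ (g , eq′) → case (trans (sym eq) eq′) of λ ()
    ... | tail _  = plain λ (g , eq′) → case (trans (sym eq) eq′) of λ ()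

    row? : ∀ y l → (∃[ d ] locatePlace y ≡ just (l , d)) ⊎ (∀ d → locatePlace y ≢ just (l , d))
    row? y l with locatePlace y
    ... | nothing = inj₂ λ _ ()
    ... | just (i , d) with i Fin.≟ l
    ...   | yes refl = inj₁ (d , refl)
    ...   | no i≢l   = inj₂ λ { _ refl → i≢l refl }

    Answer : ℕ → (Fin k → Place) → (Var → ℤ) → Place → (Var → ℤ) → Fin k → Set
    Answer r P s y t l = ∃[ tᵢ ] (Agree t tᵢ y × (∀ j → j ≢ l → Agree s tᵢ (P j)) ×
      (∀ P′ → P′ l ≡ y → (∀ j → j ≢ l → P′ j ≡ P j) → Wins {k} r P′ tᵢ))

    tracked-wins : ∀ r {P σ} → Tracked r P σ → Wins {k} r P ⟦ σ ⟧
    tracked-wins zero {P} {σ} T i = ¬hub⇒satisfies σ (P i) (¬hub (P i) (Tracked.on T i))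
      where
      ¬hub : ∀ y {i c} → locatePlace y ≡ just (i , c) → ¬ IsHub y
      ¬hub (just x) loc (g , eq) with () ← trans (sym loc) (cong locate eq)
    tracked-wins (suc r) {P} {σ} T = tracked-wins r (weaken T) , λ y → answer y (kind y)
      where
      open Tracked T

      agree-removal : ∀ l j → j ≢ l → Agree ⟦ σ ⟧ ⟦ σ ⊕ removal l ⟧ (P j)
      agree-removal l j j≢l = silent⇒agree σ (removal l) (P j) (null⇒silent (removal-null (c j) j≢l) (P j) (on j))

      remove : ∀ y l → Silent (removal l) y → Answer r P ⟦ σ ⟧ y ⟦ σ ⟧ l
      remove y l silent = ⟦ σ ⊕ removal l ⟧ , silent⇒agree σ (removal l) y silent , agree-removal l ,
        λ P′ _ _ → full-wins r (σ ⊕ removal l) (full-⊕ T (removal l) (∑-removal l) (∑-0 k)) P′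

      replace : ∀ y l d → locatePlace y ≡ just (l , d) → Answer r P ⟦ σ ⟧ y ⟦ σ ⟧ l
      replace y l d loc = go (reroute c′)
        where
        c′ : Fin k → ℕ
        c′ j with j Fin.≟ l
        ... | yes _ = d
        ... | no _  = c j
        c′-new : c′ l ≡ d
        c′-new with l Fin.≟ l
        ... | yes _ = refl
        ... | no ≢  = ⊥-elim (≢ refl)
        c′-old : ∀ j → j ≢ l → c′ j ≡ c j
        c′-old j j≢l with j Fin.≟ l
        ... | yes eq = ⊥-elim (j≢l eq)
        ... | no _   = refl
        go : (∃[ δ ] (∑ (base δ) ≡ - φ × (∀ i → NullAt δ i (c′ i)))) ⊎ ∃[ d ] Winding c′ d →
             Answer r P ⟦ σ ⟧ y ⟦ σ ⟧ l
        go (inj₁ (δ , ∑≡ , null)) = ⟦ σ ⊕ δ ⟧ ,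
          silent⇒agree σ δ y (null⇒silent (subst (NullAt δ l) c′-new (null l)) y loc) ,
          (λ j j≢l → silent⇒agree σ δ (P j) (null⇒silent (subst (NullAt δ j) (c′-old j j≢l) (null j)) (P j) (on j))) ,
          λ P′ _ _ → full-wins r (σ ⊕ δ) (full-⊕ T δ ∑≡ (∑-zero (λ i → NullAt.drained≡0 (null i)))) P′
        go (inj₂ (_ , winding)) = ⟦ σ ⟧ , agree-refl ⟦ σ ⟧ y , (λ j _ → agree-refl ⟦ σ ⟧ (P j)) ,
          λ P′ new old → tracked-wins r (Track.tracked T l (on′ P′ new old) c′-old winding)
          where
          on′ : ∀ P′ → P′ l ≡ y → (∀ j → j ≢ l → P′ j ≡ P j) → ∀ j → locatePlace (P′ j) ≡ just (j , c′ j)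
          on′ P′ new old j with j Fin.≟ l
          ... | yes refl = trans (cong locatePlace new) loc
          ... | no j≢l   = trans (cong locatePlace (old j j≢l)) (on j)

      a : Fin k
      a = proj₁ (nonzero-column T)

      -- A pebble on the second hub is answered by moving the violation to the first hub through
      -- the unpebbled tail a; it disappears once a row l is given up.
      detour : Flow
      detour = record { twist = 0ℤ ; height = λ _ _ → 0ℤ ; base = λ _ → 0ℤ ; drained = λ i → [ i ≡? a ] * φ }

      escape : Fin k → Flow
      escape l = record { twist = 0ℤ ; height = λ _ _ → 0ℤ ; base = base (removal l)
                        ; drained = λ i → [ i ≡? a ] * φ - [ i ≡? l ] * φ }

      escape-silent : ∀ l j → j ≢ l → Silent (escape l) (P j)
      escape-silent l j j≢l with P j | on j | null⇒silent (removal-null (c j) j≢l) (P j) (on j)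
      ... | just x | loc | silent = go (spot x) loc silent
        where
        go : ∀ s → locate s ≡ just (j , c j) → (∀ q → ⟦ removal l ⟧ (port s q) ≡ 0ℤ) → ∀ q → ⟦ escape l ⟧ (port s q) ≡ 0ℤ
        go (tor i d) _ sil 0F = sil 0F
        go (tor i d) _ sil 1F = sil 1F
        go (tor i d) _ sil 2F = sil 2F
        go (tor i d) _ sil 3F = sil 3F
        go (tor i d) _ sil (4F+ _) = refl
        go (tail i) loc sil with j Fin.≟ a
        ... | yes refl = ⊥-elim (proj₂ (nonzero-column T) (sym (cong proj₂ (Maybe.just-injective loc))))
        ... | no j≢a = λ where
                0F → sil 0F
                1F → drained≡0′
                2F → cong₂ _-_ (sil 0F) drained≡0′
                3F → refl
                (4F+ _) → refl
              where
              drained≡0′ : [ i ≡? a ] * φ - [ i ≡? l ] * φ ≡ 0ℤ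
              drained≡0′ with refl ← cong proj₁ (Maybe.just-injective loc) =
                cong₂ (λ x y → x * φ - y * φ) ([≢] j≢a) ([≢] j≢l)

      -- In row `l`, both the base and the part drained to the first hub drop by `φ`, so the second
      -- hub sees no difference. Hence a single answer there suits every `l`.
      escape-hub : ∀ l q → ⟦ σ ⊕ detour ⟧ (port (hub 1F) q) ≡ ⟦ σ ⊕ escape l ⟧ (port (hub 1F) q)
      escape-hub l 0F = refl
      escape-hub l 1F = refl
      escape-hub l 2F = refl
      escape-hub l 3F = refl
      escape-hub l (4F+ i) = trans (⟦⊕⟧ σ detour (drain 1F i)) (trans (cong (_+_ (⟦ σ ⟧ (drain 1F i))) (lem [ i ≡? a ] [ i ≡? l ] φ))
                               (sym (⟦⊕⟧ σ (escape l) (drain 1F i))))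
        where
        lem : ∀ a l f → 0ℤ + 0ℤ - 0ℤ - a * f ≡ l * - f + 0ℤ - 0ℤ - (a * f - l * f)
        lem = solve-∀

      ∑-escape : ∀ l → ∑ (drained (escape l)) ≡ 0ℤ
      ∑-escape l = trans (∑-difference (λ i → [ i ≡? a ] * φ) (λ i → [ i ≡? l ] * φ))
        (trans (cong₂ _-_ (∑-[] a φ) (∑-[] l φ)) (ℤ.+-inverseʳ φ))

      answer : ∀ y → Kind y → ∃[ t ] (∀ l → Answer r P ⟦ σ ⟧ y t l)
      answer y (plain ¬hub) = ⟦ σ ⟧ , λ l → go l (row? y l)
        where
        go : ∀ l → (∃[ d ] locatePlace y ≡ just (l , d)) ⊎ (∀ d → locatePlace y ≢ just (l , d)) → Answer r P ⟦ σ ⟧ y ⟦ σ ⟧ l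
        go l (inj₁ (d , loc)) = replace y l d loc
        go l (inj₂ ¬row)      = remove y l (removal-silent l y ¬hub ¬row)
      -- The first hub is not violated, and a removal leaves the flow into it unchanged.
      answer y (hubᵏ x 0F refl eq) = ⟦ σ ⟧ , λ l → remove y l (subst (λ s → ∀ q → ⟦ removal l ⟧ (port s q) ≡ 0ℤ) (sym eq) (silent l))
        where
        silent : ∀ l q → ⟦ removal l ⟧ (port (hub 0F) q) ≡ 0ℤ
        silent l 0F = refl
        silent l 1F = refl
        silent l 2F = refl
        silent l 3F = refl
        silent l (4F+ _) = refl
      answer y (hubᵏ x 1F refl eq) = ⟦ σ ⊕ detour ⟧ , λ l → ⟦ σ ⊕ escape l ⟧ ,
        subst (λ s → ∀ q → ⟦ σ ⊕ detour ⟧ (port s q) ≡ ⟦ σ ⊕ escape l ⟧ (port s q)) (sym eq) (escape-hub l) ,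
        (λ j j≢l → silent⇒agree σ (escape l) (P j) (escape-silent l j j≢l)) ,
        λ P′ _ _ → full-wins r (σ ⊕ escape l) (full-⊕ T (escape l) (∑-removal l) (∑-escape l)) P′

-- Spoiler's strategy and the resulting late split.

module Spoiler (k : ℕ) (2≤k : 2 ≤ k) (p : Fin k → ℕ) (3≤p : ∀ i → 3 ≤ p i) (C pads : ℕ)
               (room : ∀ i → p i ℕ.* p (Cycle.next k {{ℕ.>-nonZero (ℕ.<⇒≤ 2≤k)}} i) ≤ C) where

  open Construction k 2≤k p 3≤p C pads
  open Cycle k
  open Congruence M

  private
    period : Fin k → ℕ
    period i = p i ℕ.* p (next i)

    instance
      period-nonZero : ∀ {i} → NonZero (period i)
      period-nonZero {i} = ℕ.m*n≢0 (p i) (p (next i))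

  col : Fin k → ℕ → Fin C
  col i m = fromℕ< (ℕ.<-≤-trans (ℕ.m%n<n m (period i)) (room i))

  toℕ-col : ∀ i m → toℕ (col i m) ≡ m ℕ.% period i
  toℕ-col i m = Fin.toℕ-fromℕ< (ℕ.<-≤-trans (ℕ.m%n<n m (period i)) (room i))

  col-% : ∀ i m → toℕ (col i m) ℕ.% p i ≡ m ℕ.% p i
  col-% i m = trans (cong (ℕ._% p i) (toℕ-col i m)) (ℕ.m∣n⇒o%n%m≡o%m (p i) (period i) m (ℕ.m∣m*n (p (next i))))

  col-%′ : ∀ i m → toℕ (col i m) ℕ.% p (next i) ≡ m ℕ.% p (next i)
  col-%′ i m = trans (cong (ℕ._% p (next i)) (toℕ-col i m)) (ℕ.m∣n⇒o%n%m≡o%m (p (next i)) (period i) m (ℕ.n∣m*n (p i)))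

  suc-col-% : ∀ i m → suc (toℕ (col i m)) ℕ.% p i ≡ suc m ℕ.% p i
  suc-col-% i m = trans (sym (S% (toℕ (col i m)) i)) (trans (cong (λ x → suc x ℕ.% p i) (col-% i m)) (S% m i))

  suc-col-%′ : ∀ i m → suc (toℕ (col i m)) ℕ.% p (next i) ≡ suc m ℕ.% p (next i)
  suc-col-%′ i m = trans (sym (S% (toℕ (col i m)) (next i))) (trans (cong (λ x → suc x ℕ.% p (next i)) (col-%′ i m)) (S% m (next i)))

  column : ℕ → Vec (Fin B) k
  column m = tabulate (λ i → at (tor i (col i m)))

  tails : Vec (Fin B) k
  tails = tabulate (at ∘ tail)

  spot-column : ∀ m i → spot (lookup (column m) i) ≡ tor i (col i m)
  spot-column m i = trans (cong spot (Vec.lookup∘tabulate (λ i → at (tor i (col i m))) i)) (spot-at (tor i (col i m)))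

  spot-tails : ∀ i → spot (lookup tails i) ≡ tail i
  spot-tails i = trans (cong spot (Vec.lookup∘tabulate (at ∘ tail) i)) (spot-at (tail i))

  differ : ∀ {x y : Fin B} {s t} → spot x ≡ s → spot y ≡ t → s ≢ t → x ≢ y
  differ eq eq′ s≢t refl = s≢t (trans (sym eq) eq′)

  private
    rows≢ : ∀ m {i j} → i ≢ j → lookup (column m) i ≢ lookup (column m) j
    rows≢ m i≢j = differ (spot-column m _) (spot-column m _) λ { refl → i≢j refl }

    columns≢ : ∀ m i → lookup (column m) i ≢ lookup (column (suc m)) i
    columns≢ m i = differ (spot-column m i) (spot-column (suc m) i) λ eq →
      Profile.S≢ (p i) (3≤p i) (m ℕ.% p i) (trans (S% m i) (sym (col≡⇒%≡ (tor-injective eq))))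
      where
      tor-injective : ∀ {c d} → tor i c ≡ tor i d → c ≡ d
      tor-injective refl = refl
      col≡⇒%≡ : col i m ≡ col i (suc m) → m ℕ.% p i ≡ suc m ℕ.% p i
      col≡⇒%≡ eq = trans (sym (col-% i m)) (trans (cong (λ c → toℕ c ℕ.% p i) eq) (col-% i (suc m)))

    port-at : ∀ {x s} q → spot x ≡ s → var x q ≡ port s q
    port-at q eq = cong (λ s → port s q) eq

    other : ∀ i → ∃[ j ] j ≢ i
    other i = next i , next≢ 2≤k i

    flow≡ : ∀ {i a a′ b b′} → a ≡ a′ → b ≡ b′ → _≡_ {A = Var} (flow i a b) (flow i a′ b′)
    flow≡ refl refl = refl

    pin-at : ∀ {x s} f → spot x ≡ s → pin x f ≡ ∑ (λ q → sign s q * f q)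
    pin-at f eq = cong (λ s → ∑ (λ q → sign s q * f q)) eq

  advance : ∀ r {m v} → Alike (k ℕ.+ r) (column m) v →
    ∃[ v′ ] (Alike r (column (suc m)) v′ × (∀ i → read v′ i 0F ≡ read v i 1F))
  advance r {m} = alike-replace r (λ _ → 1F) (λ _ → 0F) other (columns≢ m) λ i →
    trans (port-at 1F (spot-column m i)) (trans
      (flow≡ (trans (suc-col-% i m) (sym (col-% i (suc m)))) (trans (suc-col-%′ i m) (sym (col-%′ i (suc m)))))
      (sym (port-at 0F (spot-column (suc m) i))))

  -- The row edges leaving column `m` enter column `suc m`, which is column 0 for every period and
  -- hence the entrance to the tails.
  leave : ∀ r {m v} → (∀ j → p j ℕ.∣ suc m) → Alike (k ℕ.+ r) (column m) v →
    ∃[ v′ ] (Alike r tails v′ × (∀ i → read v′ i 0F ≡ read v i 1F))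
  leave r {m} p∣ = alike-replace r (λ _ → 1F) (λ _ → 0F) other
    (λ i → differ (spot-column m i) (spot-tails i) λ ()) λ i →
    trans (port-at 1F (spot-column m i)) (trans
      (flow≡ (trans (suc-col-% i m) (ℕ.n∣m⇒m%n≡0 (suc m) (p i) (p∣ i)))
             (trans (suc-col-%′ i m) (ℕ.n∣m⇒m%n≡0 (suc m) (p (next i)) (p∣ (next i)))))
      (sym (port-at 0F (spot-tails i))))

  -- When the `k` balances are added, the cross edges cancel around the cylinder.
  conserved : ∀ r {m v} → Alike r (column m) v → ∑ (λ i → read v i 0F) ≅ ∑ (λ i → read v i 1F)
  conserved r {m} {v} al = ≅-trans (≅-reflexive (sym total)) (≅-trans
      (+-cong (∑-≅ M balance) (≅-refl {∑ (λ i → read v i 1F)}))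
      (≅-reflexive (trans (cong (_+ ∑ (λ i → read v i 1F)) (∑-0 k)) (ℤ.+-identityˡ _))))
    where
    iso = alike⇒iso r al
    R : Fin D → Fin k → ℤ
    R q i = read v i q
    lem : ∀ a b c d {z} → z ≡ 0ℤ → 1ℤ * a + (-1ℤ * b + (1ℤ * c + (-1ℤ * d + z))) ≡ a - b + (c - d)
    lem a b c d refl = lem₀ a b c d
      where
      lem₀ : ∀ a b c d → 1ℤ * a + (-1ℤ * b + (1ℤ * c + (-1ℤ * d + 0ℤ))) ≡ a - b + (c - d)
      lem₀ = solve-∀
    neighbour : ∀ i → R 3F i ≡ R 2F (next i)
    neighbour i = read-compat iso i (next i) (rows≢ m (next≢ 2≤k i ∘ sym)) 3F 2F
      (trans (port-at 3F (spot-column m i)) (trans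
        (cong (λ a → cross (next i) a) (trans (col-%′ i m) (sym (col-% (next i) m))))
        (sym (port-at 2F (spot-column m (next i))))))
    balance : ∀ i → R 0F i - R 1F i + (R 2F i - R 2F (next i)) ≅ 0ℤ
    balance i = ≅-trans (≅-reflexive (sym (trans (pin-at (read v i) (spot-column m i))
      (trans (lem (R 0F i) (R 1F i) (R 2F i) (R 3F i) (∑-zero {k} λ _ → refl))
        (cong (λ z → R 0F i - R 1F i + (R 2F i - z)) (neighbour i)))))) (read-pin iso i)
    total : ∑ (λ i → R 0F i - R 1F i + (R 2F i - R 2F (next i))) + ∑ (R 1F) ≡ ∑ (R 0F)
    total = begin
      ∑ (λ i → R 0F i - R 1F i + (R 2F i - R 2F (next i))) + ∑ (R 1F)
        ≡⟨ cong (_+ ∑ (R 1F)) (∑-+ (λ i → R 0F i - R 1F i) (λ i → R 2F i - R 2F (next i))) ⟩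
      ∑ (λ i → R 0F i - R 1F i) + ∑ (λ i → R 2F i - R 2F (next i)) + ∑ (R 1F)
        ≡⟨ cong₂ (λ x y → x + y + ∑ (R 1F)) (∑-difference (R 0F) (R 1F))
             (trans (∑-difference (R 2F) (R 2F ∘ next)) (trans (cong (_-_ (∑ (R 2F))) (∑-next (R 2F))) (ℤ.+-inverseʳ (∑ (R 2F))))) ⟩
      ∑ (R 0F) - ∑ (R 1F) + 0ℤ + ∑ (R 1F)
        ≡⟨ lem′ (∑ (R 0F)) (∑ (R 1F)) ⟩
      ∑ (R 0F) ∎
      where
      open ≡-Reasoning
      lem′ : ∀ a b → a - b + 0ℤ + b ≡ a
      lem′ = solve-∀

  -- Each hub is inspected from this same position, so one spare round serves both.
  drained-out : ∀ {v} → Alike 1 tails v → ∑ (λ i → read v i 0F) ≅ 0ℤ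
  drained-out {v} al = ≅-trans (≅-reflexive (sym total)) (≅-trans (+-cong (∑-≅ M balance) (+-cong (hub-sum 0F 1F (λ _ → refl)) (hub-sum 1F 2F (λ _ → refl))))
      (≅-reflexive (cong (_+ 0ℤ) (∑-0 k))))
    where
    iso = alike⇒iso 1 al
    R : Fin D → Fin k → ℤ
    R q i = read v i q
    balance : ∀ i → R 0F i - R 1F i - R 2F i ≅ 0ℤ
    balance i = ≅-trans (≅-reflexive (sym (trans (pin-at (read v i) (spot-tails i))
        (lem (R 0F i) (R 1F i) (R 2F i) (R 3F i) (∑-zero {k} λ _ → refl))))) (read-pin iso i)
      where
      lem₀ : ∀ a b c d → 1ℤ * a + (-1ℤ * b + (-1ℤ * c + (0ℤ * d + 0ℤ))) ≡ a - b - c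
      lem₀ = solve-∀
      lem : ∀ a b c d {z} → z ≡ 0ℤ → 1ℤ * a + (-1ℤ * b + (-1ℤ * c + (0ℤ * d + z))) ≡ a - b - c
      lem a b c d refl = lem₀ a b c d
    hub-sum : ∀ g q → (∀ i → port (tail i) q ≡ drain g i) → ∑ (R q) ≅ 0ℤ
    hub-sum g q port≡ = ≅-trans (≅-reflexive (sym (begin
        pin y (reading (label w))    ≡⟨ pin-at (reading (label w)) (spot-at (hub g)) ⟩
        _                            ≡⟨ lem (reading (label w) 0F) (reading (label w) 1F) (reading (label w) 2F) (reading (label w) 3F) _ ⟩
        ∑ (λ i → 1ℤ * reading (label w) (4F+ i))
                                     ≡⟨ ∑-cong (λ i → trans (ℤ.*-identityˡ _) (seen i)) ⟩
        ∑ (R q) ∎))) (move-pin 0 alike i₀)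
      where
      open ≡-Reasoning
      y = at (hub g)
      moved = alike-move 0 al y
      w = proj₁ moved
      alike = proj₂ moved
      i₀ : Fin k
      i₀ = fromℕ< (ℕ.>-nonZero⁻¹ k)
      lem : ∀ a b c d z → 0ℤ * a + (0ℤ * b + (0ℤ * c + (0ℤ * d + z))) ≡ z
      lem = solve-∀
      seen : ∀ i → reading (label w) (4F+ i) ≡ R q i
      seen i = move-compat 0 alike (next≢ 2≤k i) (differ (spot-at (hub g)) (spot-tails i) λ ()) (4F+ i) q
        (trans (port-at (4F+ i) (spot-at (hub g))) (trans (sym (port≡ i)) (sym (port-at q (spot-tails i)))))
    total : ∑ (λ i → R 0F i - R 1F i - R 2F i) + (∑ (R 1F) + ∑ (R 2F)) ≡ ∑ (R 0F)
    total = trans (cong (_+ (∑ (R 1F) + ∑ (R 2F))) (trans (∑-difference (λ i → R 0F i - R 1F i) (R 2F)) (cong (_- ∑ (R 2F)) (∑-difference (R 0F) (R 1F)))))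
      (lem (∑ (R 0F)) (∑ (R 1F)) (∑ (R 2F)))
      where
      lem : ∀ a b c → a - b - c + (b + c) ≡ a
      lem = solve-∀

  -- Trading all pebbles for the next column, or for the tails, takes `k` rounds; the final 1 is for
  -- a hub.
  rounds : ℕ → ℕ
  rounds zero    = k ℕ.+ 1
  rounds (suc d) = k ℕ.+ rounds d

  walk : ∀ d {m v} → (∀ j → p j ℕ.∣ suc (m ℕ.+ d)) → Alike (rounds d) (column m) v → ∑ (λ i → read v i 1F) ≅ 0ℤ
  walk zero {m} p∣ al =
    let v′ , al′ , eq = leave 1 (λ j → subst (λ x → p j ℕ.∣ suc x) (ℕ.+-identityʳ m) (p∣ j)) al
    in  ≅-trans (≅-reflexive (∑-cong (λ i → sym (eq i)))) (drained-out al′)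
  walk (suc d) {m} p∣ al =
    let v′ , al′ , eq = advance (rounds d) al
    in  ≅-trans (≅-reflexive (∑-cong (λ i → sym (eq i)))) (≅-trans (conserved (rounds d) al′)
          (walk d (λ j → subst (λ x → p j ℕ.∣ suc x) (ℕ.+-suc m d) (p∣ j)) al′))

  module _ (L : ℕ) (apart : ∀ z → (∀ j → p j ℕ.∣ ∣ z ∣) → 1ℤ ℤ.≤ z → z + 1ℤ ℤ.≤ + L → ⊥)
           (p∣L : ∀ j → p j ℕ.∣ L) (r m : ℕ) (r<m : r < m) (m+r<L : m ℕ.+ suc r ≤ L) where

    open Duplicator L apart

    private
      i₀ : Fin k
      i₀ = fromℕ< (ℕ.>-nonZero⁻¹ k)

      σ : Flow
      -- One row carries all of `φ`. As nothing is drained to the first hub, only the second one is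
      -- violated.
      σ = record { twist = 0ℤ ; height = λ _ _ → 0ℤ ; base = λ i → [ i ≡? i₀ ] * φ ; drained = λ _ → 0ℤ }

      u v : Tuple size k
      u = origins (column m)
      v = Vec.map (vertex ∘ shift (along ⟦ σ ⟧) ∘ label) u

      P : Fin k → Place
      P i = just (lookup (column m) i)

      tracked : Tracked r P σ
      tracked = record
        { total = ∑-[] i₀ φ ; drained≡0 = ∑-0 k ; c = λ j → toℕ (col j m) ; m = λ _ → + m
        ; on = λ j → cong locate (spot-column m j)
        ; lift = λ j → Congruence.%≡⇒≅ (p j) (col-% j m)
        ; lift′ = λ j → Congruence.%≡⇒≅ (p (next j)) (col-%′ j m)
        ; near = λ _ → subst (λ z → ∣ z ∣ ≤ 1) (sym (ℤ.+-inverseʳ (+ m))) z≤n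
        ; low = λ _ → ℤ.+≤+ r<m ; high = λ _ → ℤ.+≤+ m+r<L }

      label-u : ∀ i → label (lookup u i) ≡ inj₁ (lookup (column m) i , zeros)
      label-u i = trans (cong label (Vec.lookup-map i origin (column m))) (label-vertex (inj₁ (lookup (column m) i , zeros)))

      label-v : ∀ i → label (lookup v i) ≡ shift (along ⟦ σ ⟧) (label (lookup u i))
      label-v i = trans (cong label (Vec.lookup-map i (vertex ∘ shift (along ⟦ σ ⟧) ∘ label) u)) (label-vertex _)

      same : SameColor graph k r u v
      same = wins⇒sameColor r (tracked-wins r tracked) (λ i → cong place (label-u i) , label-v i)

      read-v : ∀ i → read v i 1F ≅ [ i ≡? i₀ ] * φ
      read-v i = ≅-trans (≅-reflexive (cong (λ l → reading l 1F) (trans (label-v i) (cong (shift (along ⟦ σ ⟧)) (label-u i)))))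
        (≅-trans (values-shiftCode (along ⟦ σ ⟧ (lookup (column m) i)) zeros 1F)
        (≅-trans (+-cong (≅-trans (≅-reflexive (cong (λ j → + toℕ j) (Fin.finToFun-funToFin {D} (λ _ → residue 0ℤ) 1F))) (residue-≅ 0ℤ))
                         (≅-refl {⟦ σ ⟧ (var (lookup (column m) i) 1F)}))
        (≅-reflexive (trans (cong (λ s → 0ℤ + ⟦ σ ⟧ (port s 1F)) (spot-column m i)) (lem ([ i ≡? i₀ ] * φ))))))
        where
        lem : ∀ a → 0ℤ + (a + 0ℤ - 0ℤ) ≡ a
        lem = solve-∀

      d : ℕ
      d = L ℕ.∸ suc m

      m+d : suc (m ℕ.+ d) ≡ L
      m+d = ℕ.m+[n∸m]≡n (ℕ.≤-trans (ℕ.≤-reflexive (ℕ.+-comm 1 m)) (ℕ.≤-trans (ℕ.+-monoʳ-≤ m (s≤s z≤n)) m+r<L))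

      φ≇0 : ¬ (φ ≅ 0ℤ)
      φ≇0 eq = ℕ.<-irrefl (sym (∣∧<⇒≡0 (≅⇒∣ eq) (ℕ.n<1+n (k !)))) (ℕ.1≤n! k)

      split : ¬ SameColor graph k (rounds d) u v
      split al = φ≇0 (≅-trans (≅-reflexive (sym (∑-[] i₀ φ))) (≅-trans (∑-≅ M (λ i → ≅-sym (read-v i)))
        (walk d (λ j → subst (p j ℕ.∣_) (sym m+d) (p∣L j)) al)))

    late-stable : ∃[ t ] (IsIterationNumber graph k t × r < t)
    late-stable = late-split⇒iterationNumber graph k {s = rounds d} same split

-- Choice of the periods and of the constant.

halfPower : ∀ a n k r → n ℕ.^ k ≤ suc a ℕ.* suc a ℕ.* (r ℕ.* r) → AtLeastHalfPower (+ 1 / suc a) n k r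
halfPower a n k r n^k≤ = ℚ.toℚᵘ-cancel-≤ (begin
  ℚ.toℚᵘ ((+ 1 / suc a) ℚ.* (+ 1 / suc a) ℚ.* (+ (n ℕ.^ k) / 1))
    ≃⟨ ℚᵘ.≃-trans (ℚ.toℚᵘ-homo-* ((+ 1 / suc a) ℚ.* (+ 1 / suc a)) (+ (n ℕ.^ k) / 1))
         (ℚᵘ.*-cong (ℚᵘ.≃-trans (ℚ.toℚᵘ-homo-* (+ 1 / suc a) (+ 1 / suc a)) (ℚᵘ.*-cong c≃ c≃))
                    (ℚ.toℚᵘ-fromℚᵘ (mkℚᵘ (+ (n ℕ.^ k)) 0))) ⟩
  c ℚᵘ.* c ℚᵘ.* mkℚᵘ (+ (n ℕ.^ k)) 0
    ≤⟨ *≤* (subst₂ ℤ._≤_ lhs rhs (ℤ.+≤+ n^k≤)) ⟩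
  mkℚᵘ (+ (r ℕ.* r)) 0
    ≃⟨ ℚ.toℚᵘ-fromℚᵘ (mkℚᵘ (+ (r ℕ.* r)) 0) ⟨
  ℚ.toℚᵘ (+ (r ℕ.* r) / 1) ∎)
  where
  open ℚᵘ.≤-Reasoning
  c = mkℚᵘ (+ 1) a
  c≃ = ℚ.toℚᵘ-fromℚᵘ c
  lhs : + (n ℕ.^ k) ≡ (1ℤ * 1ℤ * + (n ℕ.^ k)) * 1ℤ
  lhs = lem (+ (n ℕ.^ k))
    where
    lem : ∀ z → z ≡ (1ℤ * 1ℤ * z) * 1ℤ
    lem = solve-∀
  rhs : + (suc a ℕ.* suc a ℕ.* (r ℕ.* r)) ≡ + (r ℕ.* r) * + (suc a ℕ.* suc a ℕ.* 1)
  rhs = trans (cong +_ (trans (ℕ.*-comm (suc a ℕ.* suc a) (r ℕ.* r)) (cong ((r ℕ.* r) ℕ.*_) (sym (ℕ.*-identityʳ (suc a ℕ.* suc a))))))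
    (ℤ.pos-* (r ℕ.* r) (suc a ℕ.* suc a ℕ.* 1))

1/-positive : ∀ a → 0ℚ <ℚ + 1 / suc a
1/-positive a = ℚ.toℚᵘ-cancel-< (ℚᵘ.<-respʳ-≃ (ℚᵘ.≃-sym (ℚ.toℚᵘ-fromℚᵘ (mkℚᵘ (+ 1) a)))
  (*<* (ℤ.+<+ (s≤s z≤n))))

-- `z` is the integer part of the square root of `n / G`: the order of magnitude of the periods for
-- which the graph still fits into `n` vertices.
between-squares : ∀ G n → 1 ≤ G → G ≤ n →
  ∃[ z ] (1 ≤ z × G ℕ.* (z ℕ.* z) ≤ n × n < G ℕ.* (suc z ℕ.* suc z))
between-squares G n 1≤G G≤n with least (λ z → n ℕ.<? G ℕ.* (suc z ℕ.* suc z)) {n} n-large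
  where
  n-large : n < G ℕ.* (suc n ℕ.* suc n)
  n-large = ℕ.≤-trans (ℕ.m≤m*n (suc n) (suc n)) (ℕ.m≤n*m (suc n ℕ.* suc n) G {{ℕ.>-nonZero 1≤G}})
... | zero  , n<G , _ = ⊥-elim (ℕ.<⇒≱ n<G (ℕ.≤-trans (ℕ.≤-reflexive (ℕ.*-identityʳ G)) G≤n))
... | suc z , n<  , minimal = suc z , s≤s z≤n , ℕ.≮⇒≥ (λ n<′ → ℕ.1+n≰n (minimal z n<′)) , n<

^-distribʳ-* : ∀ k m n → (m ℕ.* n) ℕ.^ k ≡ m ℕ.^ k ℕ.* n ℕ.^ k
^-distribʳ-* zero    m n = refl
^-distribʳ-* (suc k) m n = trans (cong (m ℕ.* n ℕ.*_) (^-distribʳ-* k m n)) (lem m n (m ℕ.^ k) (n ℕ.^ k))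
  where
  lem : ∀ m n x y → m ℕ.* n ℕ.* (x ℕ.* y) ≡ m ℕ.* x ℕ.* (n ℕ.* y)
  lem = solve-∀ℕ

-- The moduli of Gödel's β-function
module Moduli (k : ℕ) (2≤k : 2 ≤ k) (z : ℕ) (1≤z : 1 ≤ z) where

  -- The factor `k !` is a multiple of all differences of indices, which yields coprimality; the
  -- factor `z` sets the size.
  w : ℕ
  w = k ! ℕ.* z

  modulus : Fin k → ℕ
  modulus i = suc (suc (toℕ i) ℕ.* w)

  2z≤w : 2 ℕ.* z ≤ w
  2z≤w = ℕ.*-monoˡ-≤ z (ℕ.∣⇒≤ {{k ℕ.!≢0}} (ℕ.m≤n⇒m!∣n! 2≤k))

  2z≤modulus : ∀ i → 2 ℕ.* z ≤ modulus i
  2z≤modulus i = ℕ.≤-trans 2z≤w (ℕ.m≤n⇒m≤1+n (ℕ.m≤m+n w (toℕ i ℕ.* w)))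

  3≤modulus : ∀ i → 3 ≤ modulus i
  3≤modulus i = s≤s (ℕ.≤-trans (ℕ.*-monoʳ-≤ 2 1≤z) (ℕ.≤-trans 2z≤w (ℕ.m≤m+n w (toℕ i ℕ.* w))))

  modulus≤ : ∀ i → modulus i ≤ suc (k ℕ.* w)
  modulus≤ i = s≤s (ℕ.*-monoˡ-≤ w (Fin.toℕ<n i))

  private
    -- A common divisor divides `b * (1 + a * w) - a * (1 + b * w)`, which is `b - a`; hence it
    -- divides `k !`, then `a * w`, and finally 1.
    coprime-< : ∀ {a b} → a < b → b ≤ k → Coprime (suc (a ℕ.* w)) (suc (b ℕ.* w))
    coprime-< {a} {b} a<b b≤k {d} (d∣a , d∣b) = ℕ.∣1⇒≡1 (ℕ.∣m+n∣m⇒∣n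
        (subst (d ℕ.∣_) (ℕ.+-comm 1 (a ℕ.* w)) d∣a) (ℕ.∣n⇒∣m*n a (ℕ.∣m⇒∣m*n z d∣k!)))
      where
      split : b ℕ.* suc (a ℕ.* w) ≡ a ℕ.* suc (b ℕ.* w) ℕ.+ (b ℕ.∸ a)
      split = trans (lem a (b ℕ.∸ a) w (sym (ℕ.m+[n∸m]≡n (ℕ.<⇒≤ a<b)))) refl
        where
        lem₀ : ∀ a e w → (a ℕ.+ e) ℕ.* (1 ℕ.+ a ℕ.* w) ≡ a ℕ.* (1 ℕ.+ (a ℕ.+ e) ℕ.* w) ℕ.+ e
        lem₀ = solve-∀ℕ
        lem : ∀ a e w {b} → b ≡ a ℕ.+ e → b ℕ.* suc (a ℕ.* w) ≡ a ℕ.* suc (b ℕ.* w) ℕ.+ e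
        lem a e w refl = lem₀ a e w
      d∣b-a : d ℕ.∣ b ℕ.∸ a
      d∣b-a = ℕ.∣m+n∣m⇒∣n (subst (d ℕ.∣_) split (ℕ.∣n⇒∣m*n b d∣a)) (ℕ.∣n⇒∣m*n a d∣b)
      d∣k! : d ℕ.∣ k !
      d∣k! with b ℕ.∸ a in eq | d∣b-a | ℕ.m<n⇒0<n∸m a<b
      ... | suc e | d∣ | _ = ℕ.∣-trans d∣ (ℕ.∣-trans (ℕ.m∣m*n (e !))
              (ℕ.m≤n⇒m!∣n! (ℕ.≤-trans (ℕ.≤-reflexive (sym eq)) (ℕ.≤-trans (ℕ.m∸n≤m b a) b≤k))))

  modulus-coprime : ∀ {i j} → i ≢ j → Coprime (modulus i) (modulus j)
  modulus-coprime {i} {j} i≢j with ℕ.<-cmp (toℕ i) (toℕ j)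
  ... | tri< i<j _ _ = coprime-< (s≤s i<j) (Fin.toℕ<n j)
  ... | tri≈ _ i≡j _ = ⊥-elim (i≢j (Fin.toℕ-injective i≡j))
  ... | tri> _ _ j<i = Coprime.sym (coprime-< (s≤s j<i) (Fin.toℕ<n i))

  L : ℕ
  L = ∏ modulus

  apart : ∀ y → (∀ j → modulus j ℕ.∣ ∣ y ∣) → 1ℤ ℤ.≤ y → y + 1ℤ ℤ.≤ + L → ⊥
  apart (+ suc n) div _ (ℤ.+≤+ n<L) =
    ℕ.1+n≢0 (∣∧<⇒≡0 (∏-∣ modulus modulus-coprime div) (subst (_≤ L) (ℕ.+-comm (suc n) 1) n<L))
  apart (+ zero) _ (ℤ.+≤+ ()) _

  -- Places column `z ^ k` at least `z ^ k` columns away from the sink on either side.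
  2z^k≤L : z ℕ.^ k ℕ.+ z ℕ.^ k ≤ L
  2z^k≤L = begin
    z ℕ.^ k ℕ.+ z ℕ.^ k    ≡⟨ cong (z ℕ.^ k ℕ.+_) (ℕ.+-identityʳ (z ℕ.^ k)) ⟨
    2 ℕ.* z ℕ.^ k          ≤⟨ ℕ.*-monoˡ-≤ (z ℕ.^ k) (ℕ.^-monoʳ-≤ 2 (ℕ.<⇒≤ 2≤k)) ⟩
    2 ℕ.^ k ℕ.* z ℕ.^ k    ≡⟨ ^-distribʳ-* k 2 z ⟨
    (2 ℕ.* z) ℕ.^ k        ≤⟨ ∏-≥ modulus (2 ℕ.* z) 2z≤modulus ⟩
    L ∎
    where open ℕ.≤-Reasoning

resize : ∀ {m n k} {P : ℕ → Set} → m ≡ n → (G : ColoredGraph m) (r : ℕ) → IsIterationNumber G k r → P r →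
         ∃[ H ] ∃[ s ] (IsIterationNumber {n} H k s × P s)
resize refl G r iter pr = G , r , iter , pr

module Sizes (k : ℕ) (2≤k : 2 ≤ k) where

  -- `Q * z` bounds the periods, `F` is the number of vertices per site, and `G * z * z` bounds the
  -- number of vertices before padding.
  Q F G : ℕ
  Q = suc (k ℕ.* k !)
  F = suc (k !) ℕ.^ (4 ℕ.+ k)
  G = (k ℕ.* (Q ℕ.* Q) ℕ.+ (k ℕ.+ 2)) ℕ.* F

  1≤G : 1 ≤ G
  1≤G = ℕ.*-mono-≤ (ℕ.≤-trans (ℕ.<⇒≤ 2≤k) (ℕ.≤-trans (ℕ.m≤m+n k 2) (ℕ.m≤n+m (k ℕ.+ 2) (k ℕ.* (Q ℕ.* Q)))))
                   (ℕ.m^n>0 (suc (k !)) (4 ℕ.+ k))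

  4G^k-nonZero : NonZero ((4 ℕ.* G) ℕ.^ k)
  4G^k-nonZero = ℕ.>-nonZero (ℕ.m^n>0 (4 ℕ.* G) {{ℕ.>-nonZero (ℕ.*-mono-≤ (s≤s {n = 3} z≤n) 1≤G)}} k)

  module _ (a : ℕ) (suc-a : suc a ≡ (4 ℕ.* G) ℕ.^ k) (n z : ℕ) (1≤z : 1 ≤ z)
           (Gz²≤n : G ℕ.* (z ℕ.* z) ≤ n) (n<G[1+z]² : n < G ℕ.* (suc z ℕ.* suc z)) where

    private
      open Moduli k 2≤k z 1≤z
      C b pads e : ℕ
      C = suc (k ℕ.* w) ℕ.* suc (k ℕ.* w)
      b = (k ℕ.* C ℕ.+ (k ℕ.+ 2)) ℕ.* F
      pads = n ℕ.∸ b
      e = z ℕ.^ k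
      room : ∀ i → modulus i ℕ.* modulus (Cycle.next k {{ℕ.>-nonZero (ℕ.<⇒≤ 2≤k)}} i) ≤ C
      room i = ℕ.*-mono-≤ (modulus≤ i) (modulus≤ (Cycle.next k {{ℕ.>-nonZero (ℕ.<⇒≤ 2≤k)}} i))
      open Construction k 2≤k modulus 3≤modulus C pads using (graph; size)
      open Spoiler k 2≤k modulus 3≤modulus C pads room using (late-stable)

      1≤e : 1 ≤ e
      1≤e = ℕ.m^n>0 z {{ℕ.>-nonZero 1≤z}} k

      suc-pred-e : suc (ℕ.pred e) ≡ e
      suc-pred-e = ℕ.suc-pred e {{ℕ.>-nonZero 1≤e}}

      late : ∃[ r ] (IsIterationNumber graph k r × ℕ.pred e < r)
      -- The walk starts at column `e`. The predecessor makes the strict inequality in the result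
      -- read `e ≤ r`.
      late = late-stable L apart (∣-∏ modulus) (ℕ.pred e) e (ℕ.≤-reflexive suc-pred-e)
        (subst (λ x → e ℕ.+ x ≤ L) (sym suc-pred-e) 2z^k≤L)

      r : ℕ
      r = proj₁ late

      e≤r : e ≤ r
      e≤r = subst (_≤ r) suc-pred-e (proj₂ (proj₂ late))

      b≤n : b ≤ n
      b≤n = ℕ.≤-trans (begin
        b ≤⟨ ℕ.*-monoˡ-≤ F (ℕ.+-mono-≤ (ℕ.*-monoʳ-≤ k (ℕ.*-mono-≤ Q-bound Q-bound)) k+2-bound) ⟩
        (k ℕ.* ((Q ℕ.* z) ℕ.* (Q ℕ.* z)) ℕ.+ (k ℕ.+ 2) ℕ.* (z ℕ.* z)) ℕ.* F ≡⟨ lem k Q z (k ℕ.+ 2) F ⟩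
        G ℕ.* (z ℕ.* z) ∎) Gz²≤n
        where
        open ℕ.≤-Reasoning
        lem : ∀ k Q z l F → (k ℕ.* ((Q ℕ.* z) ℕ.* (Q ℕ.* z)) ℕ.+ l ℕ.* (z ℕ.* z)) ℕ.* F ≡
                            (k ℕ.* (Q ℕ.* Q) ℕ.+ l) ℕ.* F ℕ.* (z ℕ.* z)
        lem = solve-∀ℕ
        Q-bound : suc (k ℕ.* w) ≤ Q ℕ.* z
        Q-bound = ℕ.+-mono-≤ 1≤z (ℕ.≤-reflexive (sym (ℕ.*-assoc k (k !) z)))
        k+2-bound : k ℕ.+ 2 ≤ (k ℕ.+ 2) ℕ.* (z ℕ.* z)
        k+2-bound = ℕ.m≤m*n (k ℕ.+ 2) (z ℕ.* z) {{ℕ.>-nonZero (ℕ.*-mono-≤ 1≤z 1≤z)}}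

      size≡n : size ≡ n
      size≡n = ℕ.m+[n∸m]≡n b≤n

      bound : n ℕ.^ k ≤ suc a ℕ.* suc a ℕ.* (r ℕ.* r)
      bound = begin
        n ℕ.^ k                                      ≤⟨ ℕ.^-monoˡ-≤ k n≤ ⟩
        (4 ℕ.* G ℕ.* (z ℕ.* z)) ℕ.^ k                ≡⟨ ^-distribʳ-* k (4 ℕ.* G) (z ℕ.* z) ⟩
        (4 ℕ.* G) ℕ.^ k ℕ.* (z ℕ.* z) ℕ.^ k          ≡⟨ cong₂ ℕ._*_ (sym suc-a) (^-distribʳ-* k z z) ⟩
        suc a ℕ.* (e ℕ.* e)                          ≤⟨ ℕ.*-mono-≤ (ℕ.m≤m*n (suc a) (suc a)) (ℕ.*-mono-≤ e≤r e≤r) ⟩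
        suc a ℕ.* suc a ℕ.* (r ℕ.* r) ∎
        where
        open ℕ.≤-Reasoning
        lem : ∀ G z → G ℕ.* ((z ℕ.+ z) ℕ.* (z ℕ.+ z)) ≡ 4 ℕ.* G ℕ.* (z ℕ.* z)
        lem = solve-∀ℕ
        -- The 4 arises from `suc z ≤ z + z`.
        n≤ : n ≤ 4 ℕ.* G ℕ.* (z ℕ.* z)
        n≤ = ℕ.≤-trans (ℕ.<⇒≤ n<G[1+z]²) (ℕ.≤-trans (ℕ.*-monoʳ-≤ G (ℕ.*-mono-≤ (ℕ.+-monoˡ-≤ z 1≤z) (ℕ.+-monoˡ-≤ z 1≤z)))
          (ℕ.≤-reflexive (lem G z)))

    iterations : ∃[ H ] ∃[ s ] (IsIterationNumber {n} H k s × n ℕ.^ k ≤ suc a ℕ.* suc a ℕ.* (s ℕ.* s))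
    iterations = resize {P = λ s → n ℕ.^ k ≤ suc a ℕ.* suc a ℕ.* (s ℕ.* s)} size≡n graph r (proj₁ (proj₂ late)) bound

theorem1 : (k : ℕ) → 2 ≤ k →
    ∃[ c ] 0ℚ <ℚ c ×
    ∃[ nₖ ] ((n : ℕ) → nₖ ≤ n →
    ∃[ G ] ∃[ r ] IsIterationNumber {n} G k r × AtLeastHalfPower c n k r)
theorem1 k 2≤k = rational (ℕ.pred ((4 ℕ.* G) ℕ.^ k)) (ℕ.suc-pred ((4 ℕ.* G) ℕ.^ k) {{4G^k-nonZero}})
  where
  open Sizes k 2≤k
  rational : ∀ a → suc a ≡ (4 ℕ.* G) ℕ.^ k → ∃[ c ] 0ℚ <ℚ c ×
    ∃[ nₖ ] ((n : ℕ) → nₖ ≤ n → ∃[ G ] ∃[ r ] IsIterationNumber {n} G k r × AtLeastHalfPower c n k r)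
  rational a suc-a = + 1 / suc a , 1/-positive a , G , λ n G≤n →
    let z , 1≤z , Gz²≤n , n<G[1+z]² = between-squares G n 1≤G G≤n
        H , r , iter , bound = iterations a suc-a n z 1≤z Gz²≤n n<G[1+z]²
    in  H , r , iter , halfPower a n k r bound
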